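{- Let $(K,\prec)$ be an abstract elementary class with amalgamation, joint embedding and no maximal models, and let $\kappa>\mathrm{LS}(K)$ be a regular cardinal. Assume $K$ is fully $(<\kappa)$-tame, fully $(<\kappa)$-type short, and has no weak $\kappa$-order property. Assume the coheir relation $\downarrow^{\mathrm{ch}}$ (with respect to $\kappa$) has $(E)$. Then: 1. $\downarrow^{\mathrm{ch}}$ has $(C)_\kappa$, $(T)$, $(T_\ast)$, $(S)$, $(U)$ and $(L)$. 2. Any independence relation satisfying $(E)$ and $(U)$ must be $\downarrow^{\mathrm{ch}}$ (for base models in $K_{\ge\kappa}$). (Here all properties of $\downarrow^{\mathrm{ch}}$ are understood for base models in $K_{\ge\kappa}$.)
   Context: Setting. $(K,\prec)$ is an AEC with amalgamation, joint embedding and no maximal models; "model" means member of $K$; $\|M\|$ is the cardinality of $M$; $K_{\ge\kappa}$, $K_{<\kappa}$ are the classes of models of size $\ge\kappa$, $<\kappa$. We work in a monster model $\mathfrak{C}$: the union of a strictly increasing continuous chain $(\mathfrak{C}_i)_i$ of models with $\mathfrak{C}_{i+1}$ universal over $\mathfrak{C}_i$, of length $\mathrm{OR}$ (or a cardinal much bigger than the sizes of all objects considered). Every set is a subset of $\mathfrak{C}$ and every model is a $\prec$-submodel of $\mathfrak{C}$. For sequences of sets $\bar A=(A_i)_{i\in I}$, $\bar B=(B_i)_{i\in I}$ and a set $C$, $f:\bar A\equiv_C\bar B$ means $f$ is an automorphism of $\mathfrak{C}$ fixing $C$ pointwise with $f[A_i]=B_i$ for all $i$; $\bar A\equiv_C\bar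 B$ means such an $f$ exists; $C$ is omitted when empty. For sequences of elements, identify elements with singletons. $\mathrm{gtp}(\bar a/C)$ is the $\equiv_C$-class of $\bar a$. Tameness and shortness. $K$ is fully $(<\kappa)$-tame if for any tuples $\bar a,\bar b$ of the same (arbitrary) length and any model $M$, $\bar a\not\equiv_M\bar b$ implies $\bar a\not\equiv_{M_0}\bar b$ for some $M_0\prec M$ of size $<\kappa$. $K$ is fully $(<\kappa)$-type short if for any index set $I$, any $\bar a=(a_i)_{i\in I}$, $\bar b=(b_i)_{i\in I}$ and any model $M$, $\bar a\not\equiv_M\bar b$ implies $(a_i)_{i\in I_0}\not\equiv_M(b_i)_{i\in I_0}$ for some $I_0\subseteq I$ of size $<\kappa$. Weak order property. $K$ has the weak $\kappa$-order property if there are $\alpha,\beta<\kappa$, $M\in K_{<\kappa}$, distinct Galois types $p\ne q$ over $M$ of length $\alpha+\beta$, and sequences $(\bar a_i)_{i<\kappa}$ of $\alpha$-tuples and $(\bar b_i)_{i<\kappa}$ of $\beta$-tuples such that for all $i,j<\kappa$: $i\le j$ implies $\mathrm{gtp}(\bar a_i\bar b_j/M)=p$, and $i>j$ implies $\mathrm{gtp}(\bar a_i\bar b_j/M)=q$. Independence relation. A set $\downarrow$ of triples $(A,M,N)$, written $A\downarrow_M N$, with $A$ a set and $M\prec N$ models, such that: (I) if $(A,M,N)\equiv(A',M',N')$ then $A\downarrow_M N$ iff $A'\downarrow_{M'}N'$; (M) if $A\downarrow_M N$, $A'\subseteq A$, $M\prec N'\prec N$, then $A'\downarrow_M N'$;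 (B) if $A\downarrow_M N$ and $M\prec M'\prec N$ then $A\downarrow_{M'}N$. Coheir. Call a set small if it has size $<\kappa$. $A\downarrow^{\mathrm{ch}}_M N$ iff for every small $A^-\subseteq A$ and small model $N^-\prec N$ there is $B^-\subseteq M$ with $B^-\equiv_{N^- }A^-$. Properties (for $\downarrow^{\mathrm{ch}}$, read with all base models in $K_{\ge\kappa}$): $(C)_\kappa$: if $A\not\downarrow_M N$ then there are $A^-\subseteq A$, $B^-\subseteq N$ of size $<\kappa$ such that $A^-\not\downarrow_M N_0$ for all models $N_0\succ M$ containing $B^-$. $(T)$: if $M_0\prec M_1\prec M_2$, $M_1\downarrow_{M_0}N$ and $M_2\downarrow_{M_1}N$, then $M_2\downarrow_{M_0}N$. $(T_\ast)$: if $M_0\prec M_1\prec M_2$, $A\downarrow_{M_0}M_1$ and $A\downarrow_{M_1}M_2$, then $A\downarrow_{M_0}M_2$. $(S)$: if $A\downarrow_M N$ then there is $M'\succ M$ with $A\subseteq M'$ and $N\downarrow_M M'$; if $A$ is a model extending $M$, one can take $M'=A$. $(U)$: if $A\downarrow_M N$, $A'\downarrow_M N$ and $f:A\equiv_M A'$, then there is $g:A\equiv_N A'$ with $g\upharpoonright A=f\upharpoonright A$. $(E)$ is the conjunction of $(E_0)$: $A\downarrow_M M$ for all sets $A$ and models $M$; and $(E_1)$: for $M\prec N\prec N'$, if $A\downarrow_M N$ then there is $A'\equiv_N A$ with $A'\downarrow_M N'$. $(L)$: $\kappa_\alpha(\downarrow)<\infty$ for every cardinal $\alpha$, where $\kappa_\alpha(\downarrow)$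 is the least $\lambda$ which is a regular cardinal or $\infty$ such that for every regular $\mu\ge\lambda$, every increasing continuous chain of models $\langle M_i:i\le\mu\rangle$ and every set $A$ of size $\alpha$ there is $i_0<\mu$ with $A\downarrow_{M_{i_0}}M_\mu$. -}

module Defs where

open import Level using (Level; _⊔_; suc; 0ℓ)
open import Data.Empty using (⊥)
open import Data.Fin.Base using (Fin)
open import Data.Nat.Base using (ℕ)
open import Data.Product.Base using (Σ; ∃; _×_; _,_; proj₁; proj₂; Σ-syntax; ∃-syntax)
open import Data.Sum.Base using (_⊎_; [_,_]′)
open import Data.Sum.Relation.Binary.Pointwise using (_⊎ₛ_)
open import Data.Unit.Polymorphic.Base using (⊤)
open import Data.Vec.Base using (Vec; map)
import Data.Vec.Functional as Seq
open import Function.Base using (_∘_)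
open import Function.Bundles using (Injection; Bijection; _⇔_)
open import Function.Definitions using (Injective; Surjective)
open import Induction.WellFounded using (WellFounded)
open import Relation.Binary.Bundles using (Setoid)
open import Relation.Binary.Core using (Rel)
open import Relation.Binary.Definitions using (Irrelevant)
open import Relation.Binary.Structures using (IsStrictTotalOrder)
open import Relation.Binary.PropositionalEquality.Core using (_≡_; _≗_)
open import Relation.Binary.PropositionalEquality.Properties using (setoid)
import Relation.Binary.Construct.On as On
import Relation.Binary.Construct.StrictToNonStrict as StrictToNonStrict
open import Relation.Nullary.Negation.Core using (¬_)
open import Relation.Unary using (Pred; _∈_; _⊆_; _≐_)

------------------------------------------------------------------------
-- Cardinality.  "Set" in the sense of set theory is read as "type in
-- Set ℓ", "class" as "type in Set (suc ℓ)".  Sizes are compared for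
-- setoids, so that a set given by a non-injective enumeration, or by a
-- proof-relevant predicate, is counted correctly.

infix 4 _≤#_ _<#_ _≈#_

_≤#_ _<#_ _≈#_ : ∀ {a a′ b b′} → Setoid a a′ → Setoid b b′ → Set (a ⊔ a′ ⊔ b ⊔ b′)
A ≤# B = Injection A B
A <# B = (A ≤# B) × ¬ (B ≤# A)
A ≈# B = Bijection A B

elements : ∀ {a p} {A : Set a} → Pred A p → Setoid (a ⊔ p) a
elements {A = A} P = On.setoid {B = ∃ P} (setoid A) proj₁

record WellOrder (w : Level) : Set (suc w) where
  infix 4 _<_
  field
    Carrier            : Set w
    _<_                : Rel Carrier w
    isStrictTotalOrder : IsStrictTotalOrder _≡_ _<_
    wellFounded        : WellFounded _<_
    <-irrelevant       : Irrelevant _<_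

  open StrictToNonStrict _≡_ _<_ public using (_≤_)

  Segment : Carrier → Set w
  Segment i = ∃[ j ] j < i

  _⋖_ : Rel Carrier w
  i ⋖ j = (i < j) × (∀ k → i < k → ¬ (k < j))

  IsLimit : Pred Carrier w
  IsLimit i = Segment i × (∀ j → j < i → ∃[ k ] (j < k × k < i))

  IsLimitType : Set w
  IsLimitType = Carrier × (∀ i → ∃[ j ] i < j)

-- Cardinals are initial ordinals.

record Cardinal (w : Level) : Set (suc w) where
  field
    wellOrder : WellOrder w

  open WellOrder wellOrder public

  field
    initial : ∀ i → ¬ (setoid Carrier ≤# setoid (Segment i))

  size : Setoid w w
  size = setoid Carrier

∣_∣ᶜ : ∀ {w} → Cardinal w → Set w
∣ κ ∣ᶜ = Cardinal.Carrier κ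

record Regular {w} (κ : Cardinal w) : Set (suc w) where
  open Cardinal κ
  field
    infinite : setoid ℕ ≤# size
    bounded  : (X : Set w) → setoid X <# size →
               (f : X → Carrier) → ∃[ b ] (∀ x → f x < b)

------------------------------------------------------------------------
-- Structures

record Signature (ℓ : Level) : Set (suc ℓ) where
  field
    FunSym : Set ℓ
    RelSym : Set ℓ
    funAr  : FunSym → ℕ
    relAr  : RelSym → ℕ

record Structure {ℓ} (L : Signature ℓ) (c : Level) : Set (ℓ ⊔ suc c) where
  open Signature L
  field
    Carrier : Set c
    fun     : (s : FunSym) → Vec Carrier (funAr s) → Carrier
    rel     : (s : RelSym) → Pred (Vec Carrier (relAr s)) c

∣_∣ : ∀ {ℓ c} {L : Signature ℓ} → Structure L c → Set c
∣ M ∣ = Structure.Carrier M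

module _ {ℓ} {L : Signature ℓ} where
  open Signature L

  record IsEmbedding {c d} (M : Structure L c) (N : Structure L d)
                     (f : ∣ M ∣ → ∣ N ∣) : Set (ℓ ⊔ c ⊔ d) where
    field
      injective : Injective _≡_ _≡_ f
      fun-homo  : ∀ s xs → f (Structure.fun M s xs) ≡ Structure.fun N s (map f xs)
      rel-iff   : ∀ s xs → Structure.rel M s xs ⇔ Structure.rel N s (map f xs)

  IsIsomorphism : ∀ {c d} (M : Structure L c) (N : Structure L d) →
                  (∣ M ∣ → ∣ N ∣) → Set (ℓ ⊔ c ⊔ d)
  IsIsomorphism M N f = IsEmbedding M N f × Surjective _≡_ _≡_ f

------------------------------------------------------------------------
-- Abstract elementary classes.  Structures on different types cannot be
-- literal substructures of one another, so the relation M ≺ N is carried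
-- by the K-embeddings:  Strong M N f  says that f is an isomorphism of M
-- onto some f[M] ≺ N.

record AEC {ℓ} (L : Signature ℓ) : Set (suc (suc ℓ)) where
  field
    K      : Pred (Structure L ℓ) (suc ℓ)
    Strong : (M N : Structure L ℓ) → (∣ M ∣ → ∣ N ∣) → Set (suc ℓ)

  -- For u, v the inclusions of M and N in some U:  M ≺ N inside U.
  StrongIn : ∀ {c} {U : Set c} (M N : Structure L ℓ) →
             (∣ M ∣ → U) → (∣ N ∣ → U) → Set (suc ℓ ⊔ c)
  StrongIn M N u v = ∃[ f ] (Strong M N f × v ∘ f ≗ u)

  -- l is at least ∣L∣ + ℵ₀, and every subset A of M ∈ K is contained in
  -- some N ≺ M of size at most ∣A∣ + l.
  HasLS : Cardinal ℓ → Set (suc ℓ)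
  HasLS l =
    (setoid ℕ ≤# Cardinal.size l) ×
    (setoid (Signature.FunSym L ⊎ Signature.RelSym L) ≤# Cardinal.size l) ×
    (∀ M → K M → (A : Pred ∣ M ∣ ℓ) →
      Σ[ N ∈ Structure L ℓ ] Σ[ f ∈ (∣ N ∣ → ∣ M ∣) ]
        Strong N M f ×
        (∀ a → a ∈ A → ∃[ x ] f x ≡ a) ×
        (setoid ∣ N ∣ ≤# (elements A ⊎ₛ Cardinal.size l)))

  field
    strong-dom       : ∀ {M N f} → Strong M N f → K M
    strong-cod       : ∀ {M N f} → Strong M N f → K N
    strong-embedding : ∀ {M N f} → Strong M N f → IsEmbedding M N f
    strong-resp-≗    : ∀ {M N f g} → f ≗ g → Strong M N f → Strong M N g
    -- Closure of K and ≺ under isomorphism, and reflexivity of ≺.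
    strong-iso       : ∀ {M N f} → K M → IsIsomorphism M N f → Strong M N f
    strong-trans     : ∀ {M N P f g} → Strong M N f → Strong N P g → Strong M P (g ∘ f)
    coherence        : ∀ {M N P f g} → Strong N P g → Strong M P (g ∘ f) → Strong M N f

    -- Tarski–Vaught: N is the union of the increasing chain of the M i,
    -- embedded in it by the u i.
    chain :
      (δ : WellOrder ℓ) → WellOrder.IsLimitType δ → let open WellOrder δ in
      (M : Carrier → Structure L ℓ) (N : Structure L ℓ) (u : ∀ i → ∣ M i ∣ → ∣ N ∣) →
      (∀ i → IsEmbedding (M i) N (u i)) →
      (∀ i j → i < j → StrongIn (M i) (M j) (u i) (u j)) →
      (∀ x → ∃[ i ] ∃[ y ] u i y ≡ x) →
      (∀ i → Strong (M i) N (u i)) ×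
      (∀ (P : Structure L ℓ) (h : ∣ N ∣ → ∣ P ∣) →
        (∀ i → Strong (M i) P (h ∘ u i)) → Strong N P h)

    LS       : Cardinal ℓ
    hasLS    : HasLS LS
    LS-least : ∀ l → HasLS l → Cardinal.size LS ≤# Cardinal.size l

module _ {ℓ} {L : Signature ℓ} (𝒦 : AEC L) where
  open AEC 𝒦

  Amalgamation : Set (suc ℓ)
  Amalgamation =
    ∀ M₀ M₁ M₂ f₁ f₂ → Strong M₀ M₁ f₁ → Strong M₀ M₂ f₂ →
    ∃[ N ] ∃[ g₁ ] ∃[ g₂ ] (Strong M₁ N g₁ × Strong M₂ N g₂ × g₁ ∘ f₁ ≗ g₂ ∘ f₂)

  JointEmbedding : Set (suc ℓ)
  JointEmbedding =
    ∀ M₁ M₂ → K M₁ → K M₂ → ∃[ N ] ∃[ g₁ ] ∃[ g₂ ] (Strong M₁ N g₁ × Strong M₂ N g₂)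

  NoMaximalModels : Set (suc ℓ)
  NoMaximalModels =
    ∀ M → K M → ∃[ N ] ∃[ f ] (Strong M N f × ¬ Surjective _≡_ _≡_ f)

  -- The monster model: a proper class, the union of a chain of length OR.
  record Monster : Set (suc (suc ℓ)) where
    field
      OR : WellOrder (suc ℓ)

    open WellOrder OR renaming (Carrier to Ord)

    -- These two fields say that OR has the order type of the class of all
    -- ordinals.
    field
      segments-small : ∀ i → Σ[ X ∈ Set ℓ ] (setoid (Segment i) ≤# setoid X)
      small-bounded  : (X : Set ℓ) (f : X → Ord) → ∃[ b ] (∀ x → f x < b)

      ℭ      : Structure L (suc ℓ)
      ℭᵢ     : Ord → Structure L ℓ
      ι      : ∀ i → ∣ ℭᵢ i ∣ → ∣ ℭ ∣

      ι-embedding : ∀ i → IsEmbedding (ℭᵢ i) ℭ (ι i)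
      in-K        : ∀ i → K (ℭᵢ i)
      increasing  : ∀ i j → i < j → StrongIn (ℭᵢ i) (ℭᵢ j) (ι i) (ι j)
      strictly    : ∀ i j → i < j → ∃[ y ] (∀ x → ¬ (ι i x ≡ ι j y))
      continuous  : ∀ i → IsLimit i → ∀ x → ∃[ j ] (j < i × (∃[ y ] ι j y ≡ ι i x))
      union       : ∀ c → ∃[ i ] ∃[ x ] ι i x ≡ c

      -- ℭⱼ is universal over ℭᵢ for j = i + 1.
      universal : ∀ i j → i ⋖ j → ∀ N f → Strong (ℭᵢ i) N f →
                  setoid ∣ N ∣ ≤# setoid ∣ ℭᵢ i ∣ →
                  ∃[ g ] (Strong N (ℭᵢ j) g × ι j ∘ g ∘ f ≗ ι i)

------------------------------------------------------------------------
-- Subsets and submodels of the monster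

-- A small subset of U, presented as the range of a family indexed by a
-- type in Set ℓ.

record SmallSet {u} (ℓ : Level) (U : Set u) : Set (u ⊔ suc ℓ) where
  constructor range
  field
    {Index} : Set ℓ
    elem    : Index → U

⟪_⟫ : ∀ {u ℓ} {U : Set u} → SmallSet ℓ U → Pred U (u ⊔ ℓ)
⟪ range a ⟫ = λ u → ∃[ x ] a x ≡ u

#_ : ∀ {u ℓ} {U : Set u} → SmallSet ℓ U → Setoid ℓ u
#_ {U = U} (range a) = On.setoid (setoid U) a

image : ∀ {u ℓ} {U : Set u} → (U → U) → SmallSet ℓ U → SmallSet ℓ U
image f (range a) = range (f ∘ a)

module _ {ℓ} {L : Signature ℓ} {𝒦 : AEC L} (𝔐 : Monster 𝒦) where
  open AEC 𝒦
  open Monster 𝔐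

  Subset : Set (suc ℓ)
  Subset = SmallSet ℓ ∣ ℭ ∣

  -- M ≺ ℭ, i.e. M ≺ ℭᵢ for some i.
  record Model : Set (suc ℓ) where
    field
      str    : Structure L ℓ
      level  : WellOrder.Carrier OR
      into   : ∣ str ∣ → ∣ ℭᵢ level ∣
      strong : Strong str (ℭᵢ level) into

    incl : ∣ str ∣ → ∣ ℭ ∣
    incl = ι level ∘ into

    universe : Subset
    universe = range incl

    ‖_‖ : Setoid ℓ ℓ
    ‖_‖ = setoid ∣ str ∣

  open Model

  _≺_ : Model → Model → Set (suc ℓ)
  M ≺ N = StrongIn (str M) (str N) (incl M) (incl N)

  Small : Cardinal ℓ → Pred Subset (suc ℓ)
  Small κ A = # A <# Cardinal.size κ

  SmallModel : Cardinal ℓ → Pred Model ℓ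
  SmallModel κ M = ‖_‖ M <# Cardinal.size κ

  -- M ∈ K_{≥κ}
  Big : Cardinal ℓ → Pred Model ℓ
  Big κ M = Cardinal.size κ ≤# ‖_‖ M

  -- f : (A i)ᵢ ≡_C (B i)ᵢ.  An automorphism of ℭ is an automorphism of the
  -- L-structure ℭ.
  record _∶_≡[_]_ {i} {I : Set i} (f : ∣ ℭ ∣ → ∣ ℭ ∣)
                  (A : I → Subset) (C : Subset) (B : I → Subset) : Set (i ⊔ suc ℓ) where
    field
      automorphism : IsIsomorphism ℭ ℭ f
      fixes        : ∀ c → c ∈ ⟪ C ⟫ → f c ≡ c
      maps         : ∀ i → ⟪ image f (A i) ⟫ ≐ ⟪ B i ⟫

  _≡[_]_ : ∀ {i} {I : Set i} → (I → Subset) → Subset → (I → Subset) → Set (i ⊔ suc ℓ)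
  A ≡[ C ] B = ∃[ f ] (f ∶ A ≡[ C ] B)

  ∅ : Subset
  ∅ = range {Index = ⊤ × ⊥} λ ()

  one : Subset → ⊤ {0ℓ} → Subset
  one A _ = A

  singletons : ∀ {i} {I : Set i} → (I → ∣ ℭ ∣) → I → Subset
  singletons a i = range {Index = ⊤} λ _ → a i

  -- gtp(a/M) = gtp(b/M)
  SameType : ∀ {i} {I : Set i} → Model → (a b : I → ∣ ℭ ∣) → Set (i ⊔ suc ℓ)
  SameType M a b = singletons a ≡[ universe M ] singletons b

  ----------------------------------------------------------------------
  -- Tameness, shortness, and the weak order property

  FullyTame : Cardinal ℓ → Set (suc ℓ)
  FullyTame κ =
    (I : Set ℓ) (a b : I → ∣ ℭ ∣) (M : Model) → ¬ SameType M a b →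
    Σ[ M₀ ∈ Model ] (M₀ ≺ M × SmallModel κ M₀ × ¬ SameType M₀ a b)

  FullyShort : Cardinal ℓ → Set (suc ℓ)
  FullyShort κ =
    (I : Set ℓ) (a b : I → ∣ ℭ ∣) (M : Model) → ¬ SameType M a b →
    Σ[ I₀ ∈ Pred I ℓ ] (elements I₀ <# Cardinal.size κ ×
      ¬ SameType {I = ∃ I₀} M (a ∘ proj₁) (b ∘ proj₁))

  -- The two Galois types over M are given by realisations p and q.
  record WeakOrderProperty (κ : Cardinal ℓ) : Set (suc ℓ) where
    open Cardinal κ
    field
      α β : Carrier
      M   : Model
      M-small : SmallModel κ M
      p q : Segment α ⊎ Segment β → ∣ ℭ ∣
      p≢q : ¬ SameType M p q
      a   : Carrier → Segment α → ∣ ℭ ∣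
      b   : Carrier → Segment β → ∣ ℭ ∣
      ordered    : ∀ i j → i ≤ j → SameType M [ a i , b j ]′ p
      disordered : ∀ i j → j < i → SameType M [ a i , b j ]′ q

  ----------------------------------------------------------------------
  -- Independence relations

  Ternary : (r : Level) → Set (suc (ℓ ⊔ r))
  Ternary r = Subset → Model → Model → Set r

  triple : Subset → Model → Model → Fin 3 → Subset
  triple A M N = A Seq.∷ universe M Seq.∷ universe N Seq.∷ Seq.[]

  -- In  ind A M N  the base model is M, i.e. this is A ↓_M N.
  record IsIndependence {r} (ind : Ternary r) : Set (suc ℓ ⊔ r) where
    field
      domain       : ∀ {A M N} → ind A M N → M ≺ N
      invariance   : ∀ {A M N A′ M′ N′} → triple A M N ≡[ ∅ ] triple A′ M′ N′ →
                     ind A M N ⇔ ind A′ M′ N′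
      monotonicity : ∀ {A A′ M N N′} → ind A M N → ⟪ A′ ⟫ ⊆ ⟪ A ⟫ →
                     M ≺ N′ → N′ ≺ N → ind A′ M N′
      base         : ∀ {A M M′ N} → ind A M N → M ≺ M′ → M′ ≺ N → ind A M′ N

  Coheir : Cardinal ℓ → Ternary (suc ℓ)
  Coheir κ A M N =
    (M ≺ N) ×
    (∀ A⁻ N⁻ → ⟪ A⁻ ⟫ ⊆ ⟪ A ⟫ → Small κ A⁻ → N⁻ ≺ N → SmallModel κ N⁻ →
      Σ[ B⁻ ∈ Subset ] (⟪ B⁻ ⟫ ⊆ ⟪ universe M ⟫ ×
                        one B⁻ ≡[ universe N⁻ ] one A⁻))

  -- ⟨ M i : i ≤ μ ⟩, with top = M μ.
  record IsChain (μ : Cardinal ℓ) (M : ∣ μ ∣ᶜ → Model) (top : Model) : Set (suc ℓ) where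
    open Cardinal μ
    field
      increasing     : ∀ i j → i < j → M i ≺ M j
      increasing-top : ∀ i → M i ≺ top
      continuous     : ∀ i → IsLimit i → ∀ x → x ∈ ⟪ universe (M i) ⟫ →
                       ∃[ j ] (j < i × x ∈ ⟪ universe (M j) ⟫)
      continuous-top : ∀ x → x ∈ ⟪ universe top ⟫ → ∃[ j ] x ∈ ⟪ universe (M j) ⟫

  -- The properties of an independence relation, for base models in K_{≥κ}.
  -- It suffices to require this of the smallest base model involved.
  module _ (κ : Cardinal ℓ) {r} (ind : Ternary r) where

    PropertyC : Set (suc ℓ ⊔ r)
    PropertyC = ∀ A M N → Big κ M → M ≺ N → ¬ ind A M N →
      Σ[ A⁻ ∈ Subset ] Σ[ B⁻ ∈ Subset ]
        (⟪ A⁻ ⟫ ⊆ ⟪ A ⟫ × Small κ A⁻ × ⟪ B⁻ ⟫ ⊆ ⟪ universe N ⟫ × Small κ B⁻ ×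
         (∀ N₀ → M ≺ N₀ → ⟪ B⁻ ⟫ ⊆ ⟪ universe N₀ ⟫ → ¬ ind A⁻ M N₀))

    PropertyT : Set (suc ℓ ⊔ r)
    PropertyT = ∀ M₀ M₁ M₂ N → Big κ M₀ → M₀ ≺ M₁ → M₁ ≺ M₂ →
      ind (universe M₁) M₀ N → ind (universe M₂) M₁ N → ind (universe M₂) M₀ N

    PropertyT* : Set (suc ℓ ⊔ r)
    PropertyT* = ∀ A M₀ M₁ M₂ → Big κ M₀ → M₀ ≺ M₁ → M₁ ≺ M₂ →
      ind A M₀ M₁ → ind A M₁ M₂ → ind A M₀ M₂

    PropertyS : Set (suc ℓ ⊔ r)
    PropertyS =
      (∀ A M N → Big κ M → ind A M N →
        Σ[ M′ ∈ Model ] (M ≺ M′ × ⟪ A ⟫ ⊆ ⟪ universe M′ ⟫ × ind (universe N) M M′)) ×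
      (∀ A M N → Big κ M → M ≺ A → ind (universe A) M N → ind (universe N) M A)

    PropertyU : Set (suc ℓ ⊔ r)
    PropertyU = ∀ A A′ M N f → Big κ M → ind A M N → ind A′ M N →
      f ∶ one A ≡[ universe M ] one A′ →
      ∃[ g ] (g ∶ one A ≡[ universe N ] one A′ × (∀ x → x ∈ ⟪ A ⟫ → g x ≡ f x))

    PropertyE₀ : Set (suc ℓ ⊔ r)
    PropertyE₀ = ∀ A M → Big κ M → ind A M M

    PropertyE₁ : Set (suc ℓ ⊔ r)
    PropertyE₁ = ∀ A M N N′ → Big κ M → M ≺ N → N ≺ N′ → ind A M N →
      Σ[ A′ ∈ Subset ] (one A′ ≡[ universe N ] one A × ind A′ M N′)

    PropertyE : Set (suc ℓ ⊔ r)
    PropertyE = PropertyE₀ × PropertyE₁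

    -- For l regular this says κ_α(ind) ≤ l; so κ_α(ind) < ∞ means that some
    -- regular l has it.
    LocalCharacter : Cardinal ℓ → Cardinal ℓ → Set (suc ℓ ⊔ r)
    LocalCharacter α l =
      ∀ μ → Regular μ → Cardinal.size l ≤# Cardinal.size μ →
      ∀ M top → IsChain μ M top → (∀ i → Big κ (M i)) →
      ∀ A → # A ≈# Cardinal.size α → ∃[ i₀ ] ind A (M i₀) top

    PropertyL : Set (suc ℓ ⊔ r)
    PropertyL = ∀ α → Σ[ l ∈ Cardinal ℓ ] (Regular l × LocalCharacter α l)

{-# OPTIONS --safe #-}

module Submission where

-- Write a ↓_M c when every small part of a is conjugate, over every small part
-- of c, to a part of M.  The heart of the proof is a symmetry lemma: if
-- a ↓_M (M ∪ b), b* ↓_M (M ∪ a) and b* ≡_M b, then ab ≡_M ab*.  Otherwise, by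
-- shortness and tameness, this already fails for small tuples over a small
-- model, and realising alternately a over b and the earlier b_j, and b* over a
-- and the earlier a_i, gives sequences in M with a_i b_j ≡ ab for i ≤ j and
-- a_i b_j ≡ ab* for i > j: the weak order property.
--
-- Taking b* free from a and a′, the lemma gives uniqueness; moving b* to b by an
-- automorphism gives symmetry.  For local character, close off inside the top
-- model N of the chain to get W ≺ N of bounded size such that N ↓_W (W ∪ a); the
-- lemma then turns an extension of gtp(a/W) that is free over N into a itself.
-- If ↓′ is another relation with existence and uniqueness, a coheir extension and
-- a ↓′-extension which differ over b would give the weak order property again.

open import Defs
open import Level using (Level; _⊔_; suc; Lift; lift; lower)
open import Axiom.ExcludedMiddle using (ExcludedMiddle)
open import Axiom.Extensionality.Propositional using (Extensionality)
open import Data.Bool.Base using (Bool; true; false)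
open import Data.Empty using (⊥; ⊥-elim)
open import Data.Fin.Base as Fin using ()
open import Data.List.Base using (List; []; _∷_)
open import Data.Nat.Base using (ℕ)
open import Data.Product.Base using (Σ; ∃; _×_; _,_; proj₁; proj₂; Σ-syntax; ∃-syntax)
open import Data.Sum.Base as Sum using (_⊎_; inj₁; inj₂; [_,_]; [_,_]′)
open import Data.Sum.Function.Setoid using (_⊎-injection_)
open import Data.Sum.Properties using (inj₁-injective; inj₂-injective)
open import Data.Sum.Relation.Binary.Pointwise using (Pointwise-≡⇒≡; ≡⇒Pointwise-≡)
open import Data.Unit.Polymorphic.Base using (⊤; tt)
open import Data.Vec.Base using (Vec; []; _∷_; map)
open import Data.Vec.Properties using (map-∘; map-id; map-cong)
open import Function.Base using (_∘_; id)
open import Function.Bundles using (Injection; Bijection; Equivalence; _⇔_; _↣_; mk↣; mk⇔)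
import Function.Construct.Composition as Comp
open import Function.Definitions using (Surjective)
open import Induction.WellFounded using (WellFounded; module All; module FixPoint; module Subrelation)
import Relation.Binary.Construct.On as On
open import Relation.Binary.Bundles using (Setoid)
open import Relation.Binary.Core using (Rel)
open import Relation.Binary.Definitions using (tri<; tri≈; tri>)
open import Relation.Binary.PropositionalEquality hiding ([_])
open import Relation.Binary.Structures using (IsStrictTotalOrder)
open import Relation.Nullary.Decidable.Core using (yes; no; ⌊_⌋; decidable-stable)
open import Relation.Nullary.Negation.Core using (¬_; contradiction)
open import Relation.Unary using (Pred; _∈_; _⊆_)

-- The symmetry lemma concerns M ∪ b, which need not be a model, so coheir is first recast as `Coh`,
-- with an arbitrary family on the right. Families rather than sets are used throughout because
-- tameness, shortness and the order property speak of tuples, while an automorphism taking one set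
-- onto another does not record which element goes where. The lemma is about a conjugate b* because
-- b itself is not known to be free from a. Over a base in K of size at least κ, (E) always supplies
-- such a b*, and the conclusion is that b cannot be told from it over M ∪ a. The obstacle in local
-- character is uniformity: one cardinal must serve all chains, so the size of W has to be bounded
-- independently of N. The bound Z satisfies Z^κ ≤ Z and is computed from α, κ, LS(K) and one fixed
-- model of size at least κ. The regular cardinal above it is its successor, found by Hartogs'
-- argument inside OR.

module Classical (lem : ∀ {a} → ExcludedMiddle a) (ext : ∀ {a b} → Extensionality a b) where

  -- Excluded middle, choice and transfinite recursion

  by-contradiction : ∀ {a} {A : Set a} → ¬ ¬ A → A
  by-contradiction = decidable-stable lem

  ¬∀⇒∃ : ∀ {a b} {A : Set a} {B : A → Set b} → ¬ (∀ x → B x) → ∃[ x ] ¬ B x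
  ¬∀⇒∃ ¬∀ = by-contradiction λ ¬∃ → ¬∀ λ x → by-contradiction λ ¬b → ¬∃ (x , ¬b)

  -- Propositional truncation and resizing at once; conversely, Dec is not
  -- truncated, so that lem is also a global choice operator.

  Holds : ∀ {a} ℓ → Set a → Set ℓ
  Holds ℓ A with lem {P = A}
  ... | yes _ = ⊤
  ... | no _  = Lift ℓ ⊥

  module _ {a} {A : Set a} where
    holds : ∀ {ℓ} → A → Holds ℓ A
    holds x with lem {P = A}
    ... | yes _ = tt
    ... | no ¬x = lift (¬x x)

    witness : ∀ {ℓ} → Holds ℓ A → A
    witness h with lem {P = A}
    ... | yes x = x
    ... | no _  = ⊥-elim (lower h)

    Holds-irrelevant : ∀ {ℓ} (h h′ : Holds ℓ A) → h ≡ h′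
    Holds-irrelevant h h′ with lem {P = A}
    Holds-irrelevant h h′ | yes _ = refl
    Holds-irrelevant h h′ | no _  = ⊥-elim (lower h)

  Sub : ∀ {a p} {A : Set a} ℓ → (A → Set p) → Set (a ⊔ ℓ)
  Sub ℓ P = ∃[ x ] Holds ℓ (P x)

  Sub-≡ : ∀ {a p ℓ} {A : Set a} {P : A → Set p} {x y : Sub ℓ P} → proj₁ x ≡ proj₁ y → x ≡ y
  Sub-≡ {x = x , h} {y = .x , h′} refl = cong (x ,_) (Holds-irrelevant h h′)

  module _ {a b} {A : Set a} (B : A → Set b) (default : A) where

    ε : A
    ε with lem {P = ∃ B}
    ... | yes (x , _) = x
    ... | no _        = default

    ε-spec : ∃ B → B ε
    ε-spec p with lem {P = ∃ B}
    ... | yes (_ , bx) = bx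
    ... | no none      = contradiction p none

  abstract
    -- `next` has already chosen a witness for every possible history, so recursion only iterates
    -- it. As `Q` mentions the history, the specification is transported along the unfolding
    -- equation of well-founded recursion, which holds because extensionality makes `step` respect
    -- pointwise equal histories.
    wf-choice : ∀ {a r p q} {A : Set a} {_<_ : Rel A r} → WellFounded _<_ → {P : Set p}
                {Q : ∀ i → (∀ j → j < i → P) → P → Set q} →
                (∀ i rec → ∃[ x ] Q i rec x) →
                Σ[ f ∈ (A → P) ] ∀ i → Q i (λ j _ → f j) (f i)
    wf-choice {A = A} {_<_} wf {P} {Q} next = f , spec
      where
      step : ∀ i → (∀ {j} → j < i → P) → P
      step i rec = proj₁ (next i (λ j j<i → rec {j} j<i))
      step-ext : ∀ i {rec rec′ : ∀ {j} → j < i → P} → (∀ {j} j<i → rec {j} j<i ≡ rec′ j<i) →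
                 step i rec ≡ step i rec′
      step-ext i eq = cong (λ r → proj₁ (next i r)) (ext λ j → ext λ j<i → eq j<i)
      f : A → P
      f = All.wfRec wf _ (λ _ → P) step
      spec : ∀ i → Q i (λ j _ → f j) (f i)
      spec i = subst (Q i (λ j _ → f j)) (sym (FixPoint.unfold-wfRec wf (λ _ → P) step step-ext {i}))
                     (proj₂ (next i (λ j _ → f j)))

    least : ∀ {a r p} {A : Set a} {_<_ : Rel A r} → WellFounded _<_ → (P : A → Set p) →
            ∃ P → ∃[ i ] (P i × (∀ j → j < i → ¬ P j))
    least {_<_ = _<_} wf P (i , pi) = by-contradiction λ none →
      All.wfRec wf _ (λ i → ¬ P i) (λ i ih pi → none (i , pi , λ j → ih)) i pi

infixr 9 _⊙_
_⊙_ : ∀ {a a′ b b′ c c′} {A : Setoid a a′} {B : Setoid b b′} {C : Setoid c c′} →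
      B ≤# C → A ≤# B → A ≤# C
g ⊙ f = Comp.injection f g

-- Well-orders

module WellOrderProperties {w} (W : WellOrder w) where
  open WellOrder W
  open IsStrictTotalOrder isStrictTotalOrder public using (compare) renaming (trans to <-trans)

  <-irrefl : ∀ {i} → ¬ (i < i)
  <-irrefl = IsStrictTotalOrder.irrefl isStrictTotalOrder refl

  Segment-≡ : ∀ {i} {s t : Segment i} → proj₁ s ≡ proj₁ t → s ≡ t
  Segment-≡ {s = s , p} {t = .s , q} refl = cong (s ,_) (<-irrelevant p q)

  segment↣ : ∀ {i} → Segment i ↣ Carrier
  segment↣ = mk↣ Segment-≡

  ≮⇒≥ : ∀ {i j} → ¬ (i < j) → j ≤ i
  ≮⇒≥ {i} {j} i≮j with compare i j
  ... | tri< i<j _ _ = contradiction i<j i≮j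
  ... | tri≈ _ i≡j _ = inj₂ (sym i≡j)
  ... | tri> _ _ j<i = inj₁ j<i

  ≤-<-trans : ∀ {i j k} → i ≤ j → j < k → i < k
  ≤-<-trans (inj₁ i<j) j<k = <-trans i<j j<k
  ≤-<-trans (inj₂ refl) j<k = j<k

  _⊔′_ : Carrier → Carrier → Carrier
  i ⊔′ j with compare i j
  ... | tri< _ _ _ = j
  ... | tri≈ _ _ _ = j
  ... | tri> _ _ _ = i

  ≤⊔ˡ : ∀ i j → i ≤ i ⊔′ j
  ≤⊔ˡ i j with compare i j
  ... | tri< i<j _ _ = inj₁ i<j
  ... | tri≈ _ i≡j _ = inj₂ i≡j
  ... | tri> _ _ _ = inj₂ refl

  ≤⊔ʳ : ∀ i j → j ≤ i ⊔′ j
  ≤⊔ʳ i j with compare i j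
  ... | tri< i<j _ _ = inj₂ refl
  ... | tri≈ _ i≡j _ = inj₂ refl
  ... | tri> _ _ j<i = inj₁ j<i

-- Comparison of sizes, and arithmetic below a regular cardinal

module Cardinals (lem : ∀ {a} → ExcludedMiddle a) (ext : ∀ {a b} → Extensionality a b) where
  open Classical lem ext

  -- Choosing from Z, as long as possible, an element not yet listed.

  abstract
    ≰⇒segment-covers : ∀ {w z z′} (W : WellOrder w) (Z : Setoid z z′) → let open WellOrder W in
      ¬ (setoid Carrier ≤# Z) →
      ∃[ i ] Σ[ g ∈ (Segment i → Setoid.Carrier Z) ] (∀ z → ∃[ s ] Setoid._≈_ Z (g s) z)
    ≰⇒segment-covers W Z ≰ = by-contradiction λ none →
      let fresh : ∀ i (rec : ∀ j → j < i → Z.Carrier) → ∃[ z ] (∀ j j<i → ¬ (rec j j<i Z.≈ z))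
          fresh i rec = by-contradiction λ ¬fresh → none (i , (λ (j , p) → rec j p) ,
            λ z → by-contradiction λ ¬s → ¬fresh (z , λ j p e → ¬s ((j , p) , e)))
          f , new = wf-choice wellFounded {Q = λ i rec z → ∀ j j<i → ¬ (rec j j<i Z.≈ z)} fresh
      in ≰ record { to = f ; cong = λ { refl → Z.refl } ; injective = injective f new }
      where
      open WellOrder W
      open WellOrderProperties W
      module Z = Setoid Z
      injective : (f : Carrier → Z.Carrier) → (∀ i j → j < i → ¬ (f j Z.≈ f i)) →
                  ∀ {i j} → f i Z.≈ f j → i ≡ j
      injective f new {i} {j} e with compare i j
      ... | tri< i<j _ _ = contradiction e (new j i i<j)
      ... | tri≈ _ i≡j _ = i≡j
      ... | tri> _ _ j<i = contradiction (Z.sym e) (new i j j<i)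

  -- The least preimage respects the equality of Z.

  abstract
    ≰⇒≤segment : ∀ {w z z′} (W : WellOrder w) (Z : Setoid z z′) → let open WellOrder W in
      ¬ (setoid Carrier ≤# Z) → ∃[ i ] Z ≤# setoid (Segment i)
    ≰⇒≤segment {w} {z′ = z′} W Z ≰ with ≰⇒segment-covers W Z ≰
    ... | i , g , covers = i , record
      { to = s ; cong = λ {x} {y} → s-cong {x} {y}
      ; injective = λ {x} {y} e → Z.trans (Z.sym (s-spec x)) (Z.trans (Z.reflexive (cong g e)) (s-spec y)) }
      where
      open WellOrder W
      open WellOrderProperties W
      module Z = Setoid Z
      Pre : Z.Carrier → Carrier → Set (w ⊔ z′)
      Pre z j = Σ[ j<i ∈ j < i ] g (j , j<i) Z.≈ z
      first : ∀ z → ∃[ j ] (Pre z j × (∀ k → k < j → ¬ Pre z k))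
      first z = let ((j , j<i) , e) = covers z in least wellFounded (Pre z) (j , j<i , e)
      s : Z.Carrier → Segment i
      s z = let (j , (j<i , _) , _) = first z in j , j<i
      s-spec : ∀ z → g (s z) Z.≈ z
      s-spec z = let (_ , (_ , e) , _) = first z in e
      s-cong : ∀ {x y} → x Z.≈ y → s x ≡ s y
      s-cong {x} {y} e with first x | first y
      ... | j , (j<i , p) , minj | k , (k<i , q) , mink with compare j k
      ... | tri< j<k _ _ = contradiction (j<i , Z.trans p e) (mink j j<k)
      ... | tri≈ _ j≡k _ = Segment-≡ j≡k
      ... | tri> _ _ k<j = contradiction (k<i , Z.trans q (Z.sym e)) (minj k k<j)

  ≰⇒<# : ∀ {w z z′} (μ : Cardinal w) (Z : Setoid z z′) →
         ¬ (Cardinal.size μ ≤# Z) → Z <# Cardinal.size μ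
  ≰⇒<# μ Z ≰ = WellOrderProperties.segment↣ (Cardinal.wellOrder μ) ⊙ proj₂ (≰⇒≤segment (Cardinal.wellOrder μ) Z ≰) , ≰

  module Smallness {w} (κ : Cardinal w) (regular : Regular κ) where
    open Cardinal κ
    open WellOrderProperties wellOrder
    open Regular regular

    -- Only the negative half of `<#`; `≰⇒<#` recovers the other half. In this form smallness passes
    -- along injections between arbitrary universes.
    IsSmall : ∀ {x} → Set x → Set (w ⊔ x)
    IsSmall X = ¬ (Carrier ↣ X)

    small-≤ : ∀ {x y} {X : Set x} {Y : Set y} → Y ↣ X → IsSmall X → IsSmall Y
    small-≤ Y≤X small κ≤Y = small (Y≤X ⊙ κ≤Y)

    bound : {X : Set w} → IsSmall X → (f : X → Carrier) → ∃[ b ] (∀ x → f x < b)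
    bound {X} small = bounded X (≰⇒<# κ (setoid X) small)

    some : Carrier
    some = Injection.to infinite 0

    other : Carrier
    other = Injection.to infinite 1

    some≢other : ¬ some ≡ other
    some≢other e with Injection.injective infinite e
    ... | ()

    small-⊤ : IsSmall (⊤ {w})
    small-⊤ κ≤⊤ = some≢other (Injection.injective κ≤⊤ refl)

    small-Segment : ∀ i → IsSmall (Segment i)
    small-Segment = initial

    unbounded : ∀ i → ∃[ j ] i < j
    unbounded i = let (b , i<b) = bound small-⊤ (λ _ → i) in b , i<b tt

    private
      preimage : ∀ {x y} {X : Set x} {Y : Set y} → (Carrier ↣ X) → (Y → X) → Y → Carrier
      preimage j g y with lem {P = ∃[ k ] Injection.to j k ≡ g y}
      ... | yes (k , _) = k
      ... | no _        = some

      preimage-to : ∀ {x y} {X : Set x} {Y : Set y} (j : Carrier ↣ X) (g : Y → X) {y k} →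
                    Injection.to j k ≡ g y → preimage j g y ≡ k
      preimage-to j g {y} {k} e with lem {P = ∃[ k ] Injection.to j k ≡ g y}
      ... | yes (_ , e′) = Injection.injective j (trans e′ (sym e))
      ... | no none      = contradiction (k , e) none

    -- Given an injection of κ into the sum, the indices sent to the fibre over x are bounded
    -- because that fibre is small, and all these bounds lie below one `top` because X is small. But
    -- `top` itself is sent to some fibre.
    small-Σ : {X : Set w} {Y : X → Set w} → IsSmall X → (∀ x → IsSmall (Y x)) → IsSmall (Σ X Y)
    small-Σ {X} {Y} small-X small-Y κ≤ =
      <-irrefl (subst (_< top) (preimage-to κ≤ (y ,_) refl) (<-trans (proj₂ (inner y) z) (proj₂ outer y)))
      where
      inner : ∀ x → ∃[ b ] (∀ y → preimage κ≤ (x ,_) y < b)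
      inner x = bound (small-Y x) (preimage κ≤ (x ,_))
      outer = bound small-X (proj₁ ∘ inner)
      top = proj₁ outer
      y = proj₁ (Injection.to κ≤ top)
      z = proj₂ (Injection.to κ≤ top)

    small-⊎ : {X Y : Set w} → IsSmall X → IsSmall Y → IsSmall (X ⊎ Y)
    small-⊎ {X} {Y} small-X small-Y κ≤ = absurd (Injection.to κ≤ top) refl
      where
      boundˡ = bound small-X (preimage κ≤ inj₁)
      boundʳ = bound small-Y (preimage κ≤ inj₂)
      top = proj₁ boundˡ ⊔′ proj₁ boundʳ
      absurd : ∀ z → Injection.to κ≤ top ≡ z → ⊥
      absurd (inj₁ x) e = <-irrefl (≤-<-trans (≤⊔ˡ _ _)
        (subst (_< proj₁ boundˡ) (preimage-to κ≤ inj₁ e) (proj₂ boundˡ x)))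
      absurd (inj₂ y) e = <-irrefl (≤-<-trans (≤⊔ʳ _ _)
        (subst (_< proj₁ boundʳ) (preimage-to κ≤ inj₂ e) (proj₂ boundʳ y)))

    -- Sizes are measured on setoids, so a small set may come with a large index type; this
    -- exchanges the index type for a small one.
    small-representatives : ∀ {z z′} (Z : Setoid z z′) → ¬ (size ≤# Z) →
      Σ[ X ∈ Set w ] Σ[ r ∈ (X → Setoid.Carrier Z) ] (IsSmall X × (∀ z → ∃[ x ] Setoid._≈_ Z (r x) z))
    small-representatives Z ≰ =
      let (i , g , covers) = ≰⇒segment-covers wellOrder Z ≰ in Segment i , g , small-Segment i , covers

    small⇒segment : {X : Set w} → IsSmall X →
      ∃[ i ] Σ[ g ∈ (Segment i → X) ] (∀ x → ∃[ s ] g s ≡ x)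
    small⇒segment {X} small = ≰⇒segment-covers wellOrder (setoid X) small

-- Successor cardinals and closure under κ-th powers

module Hartogs (lem : ∀ {a} → ExcludedMiddle a) (ext : ∀ {a b} → Extensionality a b) where
  open Classical lem ext
  open Cardinals lem ext

  module _ {ℓ : Level} (OR : WellOrder (suc ℓ))
    (segments-small : ∀ i → Σ[ X ∈ Set ℓ ] (WellOrder.Segment OR i ↣ X))
    (small-bounded : (X : Set ℓ) (f : X → WellOrder.Carrier OR) → ∃[ b ] (∀ x → WellOrder._<_ OR (f x) b)) where
    open WellOrder OR
    open WellOrderProperties OR

    -- Such an `h` moves `i` down. If `k` is the least point moved down, monotonicity moves the
    -- smaller point `h k` down as well.
    no-monotone : ∀ {i j} → i < j → (h : Segment j → Segment i) →
      (∀ {s t} → proj₁ s < proj₁ t → proj₁ (h s) < proj₁ (h t)) → ⊥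
    no-monotone {i} {j} i<j h mono =
      let (k , (k<j , hk<k) , min) = least wellFounded Drops (i , i<j , proj₂ (h (i , i<j)))
          hk<j = <-trans hk<k k<j
      in min (proj₁ (h (k , k<j))) hk<k (hk<j , mono {hk k k<j , hk<j} {k , k<j} hk<k)
      where
      hk : ∀ k → k < j → Carrier
      hk k k<j = proj₁ (h (k , k<j))
      Drops : Carrier → Set _
      Drops k = Σ[ k<j ∈ k < j ] proj₁ (h (k , k<j)) < k

    -- If every segment embedded in Z, it could be recovered from a Bool-valued
    -- order on Z, and there is only a set of those.

    hartogs : (Z : Set ℓ) → ∃[ i ] ¬ (Segment i ↣ Z)
    hartogs Z = by-contradiction λ none → impossible λ i → by-contradiction λ ≰ → none (i , ≰)
      where
      module _ (e : ∀ i → Segment i ↣ Z) where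
        to : ∀ {i} → Segment i → Z
        to {i} = Injection.to (e i)
        Below : Carrier → Z → Z → Set _
        Below i y z = Σ[ s ∈ Segment i ] Σ[ t ∈ Segment i ] (to s ≡ y × to t ≡ z × proj₁ s ≤ proj₁ t)
        code : Carrier → Z → Z → Bool
        code i y z = ⌊ lem {P = Below i y z} ⌋
        encode : ∀ {i y z} → Below i y z → code i y z ≡ true
        encode {i} {y} {z} p with lem {P = Below i y z}
        ... | yes _ = refl
        ... | no ¬p = contradiction p ¬p
        decode : ∀ {i y z} → code i y z ≡ true → Below i y z
        decode {i} {y} {z} eq with lem {P = Below i y z}
        decode refl | yes p = p
        -- Equal codes make the passage from a point to the one with the same value in Z a strictly
        -- monotone map of the longer segment into the shorter.
        not-smaller : ∀ {i j} → code i ≡ code j → ¬ (i < j)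
        not-smaller {i} {j} eq i<j = no-monotone i<j h mono
          where
          transfer : ∀ {y z} → Below j y z → Below i y z
          transfer {y} {z} p = decode (trans (cong (λ c → c y z) eq) (encode p))
          h-spec : ∀ s → ∃[ t ] to {i} t ≡ to {j} s
          h-spec s = let (t , _ , e , _) = transfer (s , s , refl , refl , inj₂ refl) in t , e
          h : Segment j → Segment i
          h s = proj₁ (h-spec s)
          mono : ∀ {s t} → proj₁ s < proj₁ t → proj₁ (h s) < proj₁ (h t)
          mono {s} {t} s<t with transfer (s , t , refl , refl , inj₁ s<t)
          ... | s′ , t′ , es , et , s′≤t′
            with Injection.injective (e i) {s′} {h s} (trans es (sym (proj₂ (h-spec s))))
               | Injection.injective (e i) {t′} {h t} (trans et (sym (proj₂ (h-spec t))))
          mono {s} {t} s<t | _ , _ , es , et , inj₁ s′<t′ | refl | refl = s′<t′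
          mono {s} {t} s<t | _ , _ , es , et , inj₂ s′≡t′ | refl | refl =
            ⊥-elim (<-irrefl (subst (λ x → proj₁ x < proj₁ t) s≡t s<t))
            where
            s≡t : s ≡ t
            s≡t = Injection.injective (e j) (trans (sym es) (trans (cong to (Segment-≡ s′≡t′)) et))
        ordinal : (Z → Z → Bool) → Carrier
        ordinal R with lem {P = ∃[ i ] code i ≡ R}
        ... | yes (i , _) = i
        ... | no _        = proj₁ (small-bounded (Lift ℓ ⊥) λ ())
        ordinal-code : ∀ i → ordinal (code i) ≡ i
        ordinal-code i with lem {P = ∃[ j ] code j ≡ code i}
        ... | no none = contradiction (i , refl) none
        ... | yes (j , eq) with compare j i
        ... | tri< j<i _ _ = contradiction j<i (not-smaller eq)
        ... | tri≈ _ j≡i _ = j≡i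
        ... | tri> _ _ i<j = contradiction i<j (not-smaller (sym eq))
        -- The relations on Z form a type in `Set ℓ`, so `ordinal` presents all of OR as the range
        -- of a small family. Its bound would lie in that range too.
        impossible : ⊥
        impossible = let (b , <b) = small-bounded _ ordinal in
          <-irrefl (subst (_< b) (ordinal-code b) (<b (code b)))

    -- OR lives one universe above the wanted well-order; `Holds` resizes the pulled-back order and
    -- makes it irrelevant at the same time.
    restrict : {C : Set ℓ} → C ↣ Carrier → WellOrder ℓ
    restrict {C} f = record
      { Carrier = C
      ; _<_ = λ x y → Holds ℓ (to x < to y)
      ; isStrictTotalOrder = record
        { isStrictPartialOrder = record
          { isEquivalence = isEquivalence
          ; irrefl = λ { refl x<x → <-irrefl (witness x<x) }
          ; trans = λ p q → holds (<-trans (witness p) (witness q))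
          ; <-resp-≈ = (λ { refl p → p }) , (λ { refl p → p }) }
        ; compare = compare′ }
      ; wellFounded = Subrelation.wellFounded witness (On.wellFounded to wellFounded)
      ; <-irrelevant = Holds-irrelevant }
      where
      open Injection f using (to; injective)
      compare′ : ∀ x y → _
      compare′ x y with compare (to x) (to y)
      ... | tri< p ¬q ¬r = tri< (holds p) (λ e → ¬q (cong to e)) (λ r → ¬r (witness r))
      ... | tri≈ ¬p q ¬r = tri≈ (λ p → ¬p (witness p)) (injective q) (λ r → ¬r (witness r))
      ... | tri> ¬p ¬q r = tri> (λ p → ¬p (witness p)) (λ e → ¬q (cong to e)) (holds r)

    -- As `i₀` is the least ordinal that does not embed in Z, this is the successor cardinal of Z.
    -- `C` copies the segment of `i₀` into `Set ℓ` as a part of X, since X is only known to be large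
    -- enough.
    module Successor (Z : Set ℓ) (ℕ≤Z : ℕ ↣ Z) (pair : ((Z × Z) × Bool) ↣ Z)
      (i₀ : Carrier) (segment≰Z : ¬ (Segment i₀ ↣ Z)) (segment≤Z : ∀ i → i < i₀ → Segment i ↣ Z)
      (X : Set ℓ) (j : Segment i₀ ↣ X) where
      C : Set ℓ
      C = Sub ℓ (λ x → ∃[ s ] Injection.to j s ≡ x)
      f : C → Segment i₀
      f (x , h) = proj₁ (witness h)
      f-spec : ∀ c → Injection.to j (f c) ≡ proj₁ c
      f-spec (x , h) = proj₂ (witness h)
      f-inj : C ↣ Segment i₀
      f-inj = mk↣ {to = f} λ {c} {d} e →
        Sub-≡ (trans (sym (f-spec c)) (trans (cong (Injection.to j) e) (f-spec d)))
      segment≤C : Segment i₀ ↣ C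
      segment≤C = mk↣ {to = λ s → Injection.to j s , holds (s , refl)}
        λ e → Injection.injective j (cong proj₁ e)
      C≰Z : ¬ (C ↣ Z)
      C≰Z C≤Z = segment≰Z (C≤Z ⊙ segment≤C)
      W : WellOrder ℓ
      W = restrict (segment↣ ⊙ f-inj)
      segmentC≤Z : ∀ c → WellOrder.Segment W c ↣ Z
      segmentC≤Z c = segment≤Z _ (proj₂ (f c)) ⊙
        mk↣ {to = λ (d , d<c) → proj₁ (f d) , witness d<c}
          λ e → WellOrderProperties.Segment-≡ W (Injection.injective f-inj (Segment-≡ (cong proj₁ e)))
      μ : Cardinal ℓ
      μ = record { wellOrder = W ; initial = λ c C≤ → C≰Z (segmentC≤Z c ⊙ C≤) }
      μ≰Z : ¬ (Cardinal.size μ ≤# setoid Z)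
      μ≰Z = C≰Z
      regular : Regular μ
      regular = record
        { infinite = proj₁ (≰⇒<# μ (setoid ℕ) λ μ≤ℕ → C≰Z (ℕ≤Z ⊙ μ≤ℕ))
        ; bounded  = λ Y (_ , μ≰Y) g → by-contradiction λ unbounded → C≰Z (C≤Z Y μ≰Y g unbounded) }
        where
        module W = WellOrder W
        -- The usual regularity of a successor: if `g` were unbounded, C would be covered by the
        -- closed initial segments up to the values of `g`, which are at most Z many sets, each
        -- embedding in Z up to one point. The Boolean separates c < g y from c ≡ g y.
        C≤Z : ∀ Y → ¬ (C ↣ Y) → (g : Y → C) → ¬ (∃[ b ] (∀ y → g y W.< b)) → C ↣ Z
        C≤Z Y μ≰Y g unbounded = pair ⊙ mk↣ {to = λ c → code (dominated c)}
            λ {c} {d} → code-injective (dominated c) (dominated d)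
          where
          Y≤Z : Y ↣ Z
          Y≤Z = let (c , Y≤) = ≰⇒≤segment W (setoid Y) μ≰Y in segmentC≤Z c ⊙ Y≤
          dominated : ∀ c → ∃[ y ] c W.≤ g y
          dominated c = let (y , ≮) = ¬∀⇒∃ {B = λ y → g y W.< c} (λ all → unbounded (c , all))
            in y , WellOrderProperties.≮⇒≥ W ≮
          part : ∀ {c d} → c W.≤ d → Z × Bool
          part {c} {d} (inj₁ c<d) = Injection.to (segmentC≤Z d) (c , c<d) , true
          part (inj₂ _)           = Injection.to ℕ≤Z 0 , false
          part-injective : ∀ {c c′ d} (p : c W.≤ d) (p′ : c′ W.≤ d) → part p ≡ part p′ → c ≡ c′
          part-injective (inj₁ p) (inj₁ p′) e = cong proj₁ (Injection.injective (segmentC≤Z _) (cong proj₁ e))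
          part-injective (inj₁ p) (inj₂ p′) e with cong proj₂ e
          ... | ()
          part-injective (inj₂ p) (inj₁ p′) e with cong proj₂ e
          ... | ()
          part-injective (inj₂ p) (inj₂ p′) e = trans p (sym p′)
          code : ∀ {c} → ∃[ y ] c W.≤ g y → (Z × Z) × Bool
          code (y , p) = (Injection.to Y≤Z y , proj₁ (part p)) , proj₂ (part p)
          code-injective : ∀ {c d} (p : ∃[ y ] c W.≤ g y) (q : ∃[ y ] d W.≤ g y) → code p ≡ code q → c ≡ d
          code-injective (y , p) (y′ , q) e with Injection.injective Y≤Z {y} {y′} (cong (proj₁ ∘ proj₁) e)
          ... | refl = part-injective p q (cong₂ _,_ (cong (proj₂ ∘ proj₁) e) (cong proj₂ e))

    regular-above : (Z : Set ℓ) → ℕ ↣ Z → ((Z × Z) × Bool) ↣ Z →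
      Σ[ μ ∈ Cardinal ℓ ] (Regular μ × ¬ (Cardinal.size μ ≤# setoid Z))
    regular-above Z ℕ≤Z pair with least wellFounded (λ i → ¬ (Segment i ↣ Z)) (hartogs Z)
    ... | i₀ , segment≰Z , min with segments-small i₀
    ... | X , j = μ , regular , μ≰Z
      where open Successor Z ℕ≤Z pair i₀ segment≰Z (λ i i<i₀ → by-contradiction (min i i<i₀)) X j

  module Powers {w} (κ : Cardinal w) (regular : Regular κ) (V : Set w) (v₀ v₁ : V) (v₀≢v₁ : ¬ v₀ ≡ v₁) where
    open Smallness κ regular
    private k = Cardinal.Carrier κ

    -- V to the power of the finite sequences from κ. It absorbs κ-th powers without any cardinal
    -- arithmetic: a κ-indexed family of such functions is one function, whose argument selects the
    -- member by its head.
    Z : Set w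
    Z = List k → V

    V≤Z : V ↣ Z
    V≤Z = mk↣ {to = λ v _ → v} λ e → cong (λ f → f []) e

    powers : (k → Z) ↣ Z
    powers = mk↣ {to = encode} λ {f} {g} e → ext λ i → ext λ is → cong (λ h → h (i ∷ is)) e
      where
      encode : (k → Z) → Z
      encode f []       = v₀
      encode f (i ∷ is) = f i is

    Bool≤Z : Bool ↣ Z
    Bool≤Z = V≤Z ⊙ mk↣ {to = λ { true → v₀ ; false → v₁ }} λ
      { {true} {true} _ → refl ; {true} {false} e → contradiction e v₀≢v₁
      ; {false} {true} e → contradiction (sym e) v₀≢v₁ ; {false} {false} _ → refl }

    functions : ∀ {b} {B : Set b} → B ↣ Z → (k → B) ↣ Z
    functions B≤Z = powers ⊙ mk↣ {to = λ f → Injection.to B≤Z ∘ f}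
      λ e → ext λ i → Injection.injective B≤Z (cong (λ h → h i) e)

    _×ᶻ_ : ∀ {a b} {A : Set a} {B : Set b} → A ↣ Z → B ↣ Z → (A × B) ↣ Z
    _×ᶻ_ {A = A} {B} A≤Z B≤Z = powers ⊙ mk↣ {to = encode} λ {x} {y} e →
      cong₂ _,_ (Injection.injective A≤Z (trans (sym (encode-some x)) (trans (cong (λ h → h some) e) (encode-some y))))
                (Injection.injective B≤Z (trans (sym (encode-other x)) (trans (cong (λ h → h other) e) (encode-other y))))
      where
      -- A pair becomes the κ-sequence that is a at `some` and b elsewhere; its values at `some` and
      -- `other` give the pair back.
      encode : A × B → k → Z
      encode (a , b) i with lem {P = i ≡ some}
      ... | yes _ = Injection.to A≤Z a
      ... | no _  = Injection.to B≤Z b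
      encode-some : ∀ p → encode p some ≡ Injection.to A≤Z (proj₁ p)
      encode-some p with lem {P = some ≡ some}
      ... | yes _ = refl
      ... | no ≢  = contradiction refl ≢
      encode-other : ∀ p → encode p other ≡ Injection.to B≤Z (proj₂ p)
      encode-other p with lem {P = other ≡ some}
      ... | yes e = contradiction (sym e) some≢other
      ... | no _  = refl

    _⊎ᶻ_ : ∀ {a b} {A : Set a} {B : Set b} → A ↣ Z → B ↣ Z → (A ⊎ B) ↣ Z
    _⊎ᶻ_ {A = A} {B} A≤Z B≤Z = (mk↣ {to = id {A = Z}} id ×ᶻ Bool≤Z) ⊙ mk↣ {to = tag} tag-injective
      where
      tag : A ⊎ B → Z × Bool
      tag (inj₁ a) = Injection.to A≤Z a , true
      tag (inj₂ b) = Injection.to B≤Z b , false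
      tag-injective : ∀ {x y} → tag x ≡ tag y → x ≡ y
      tag-injective {inj₁ _} {inj₁ _} e = cong inj₁ (Injection.injective A≤Z (cong proj₁ e))
      tag-injective {inj₂ _} {inj₂ _} e = cong inj₂ (Injection.injective B≤Z (cong proj₁ e))
      tag-injective {inj₁ _} {inj₂ _} e with cong proj₂ e
      ... | ()
      tag-injective {inj₂ _} {inj₁ _} e with cong proj₂ e
      ... | ()

-- Automorphisms and submodels of the monster

module MonsterModel (lem : ∀ {a} → ExcludedMiddle a) (ext : ∀ {a b} → Extensionality a b)
  {ℓ : Level} {L : Signature ℓ} {𝒦 : AEC L} (𝔐 : Monster 𝒦) where
  open Classical lem ext
  open Cardinals lem ext
  open AEC 𝒦
  open Monster 𝔐
  open Signature L
  open Model {𝔐 = 𝔐}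
  open WellOrder OR renaming (Carrier to Ord)
  open WellOrderProperties OR

  U : Set (suc ℓ)
  U = ∣ ℭ ∣

  record Aut : Set (suc ℓ) where
    field
      to from : U → U
      iso     : IsIsomorphism ℭ ℭ to
      to-from : ∀ x → to (from x) ≡ x
      from-to : ∀ x → from (to x) ≡ x
  open Aut

  toAut : ∀ f → IsIsomorphism ℭ ℭ f → Aut
  toAut f iso@(emb , surj) = record
    { to = f ; from = λ y → proj₁ (surj y) ; iso = iso
    ; to-from = λ y → proj₂ (surj y) refl
    ; from-to = λ x → IsEmbedding.injective emb (proj₂ (surj (f x)) refl) }

  idᴬ : Aut
  idᴬ = record
    { to = id ; from = id ; to-from = λ _ → refl ; from-to = λ _ → refl
    ; iso = record { injective = id
                   ; fun-homo = λ s xs → cong (Structure.fun ℭ s) (sym (map-id xs))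
                   ; rel-iff = λ s xs → subst (λ ys → Structure.rel ℭ s xs ⇔ Structure.rel ℭ s ys) (sym (map-id xs)) (mk⇔ id id) }
          , λ y → y , λ e → e }

  infixr 9 _∘ᴬ_
  _∘ᴬ_ : Aut → Aut → Aut
  σ ∘ᴬ τ = record
    { to = to σ ∘ to τ ; from = from τ ∘ from σ
    ; to-from = λ x → trans (cong (to σ) (to-from τ _)) (to-from σ x)
    ; from-to = λ x → trans (cong (from τ) (from-to σ _)) (from-to τ x)
    ; iso = record
      { injective = τ.injective ∘ σ.injective
      ; fun-homo = λ s xs → trans (cong (to σ) (τ.fun-homo s xs))
          (trans (σ.fun-homo s _) (cong (Structure.fun ℭ s) (sym (map-∘ _ _ xs))))
      ; rel-iff = λ s xs → Comp.equivalence (τ.rel-iff s xs)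
          (subst (λ ys → Structure.rel ℭ s (map (to τ) xs) ⇔ Structure.rel ℭ s ys) (sym (map-∘ _ _ xs)) (σ.rel-iff s _)) }
      , λ y → from τ (from σ y) , λ { refl → trans (cong (to σ) (to-from τ _)) (to-from σ y) } }
    where
    module σ = IsEmbedding (proj₁ (iso σ))
    module τ = IsEmbedding (proj₁ (iso τ))

  infix 10 _⁻¹
  _⁻¹ : Aut → Aut
  σ ⁻¹ = record
    { to = from σ ; from = to σ ; to-from = from-to σ ; from-to = to-from σ
    ; iso = record
      { injective = λ {x} {y} e → trans (sym (to-from σ x)) (trans (cong (to σ) e) (to-from σ y))
      ; fun-homo = λ s xs → σ.injective (trans (to-from σ _)
          (sym (trans (σ.fun-homo s _) (cong (Structure.fun ℭ s) (back xs)))))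
      ; rel-iff = λ s xs → mk⇔
          (λ r → Equivalence.from (σ.rel-iff s _) (subst (Structure.rel ℭ s) (sym (back xs)) r))
          (λ r → subst (Structure.rel ℭ s) (back xs) (Equivalence.to (σ.rel-iff s _) r)) }
      , λ y → to σ y , λ { refl → from-to σ y } }
    where
    module σ = IsEmbedding (proj₁ (iso σ))
    back : ∀ {n} (xs : Vec U n) → map (to σ) (map (from σ) xs) ≡ xs
    back xs = trans (sym (map-∘ _ _ xs)) (trans (map-cong (to-from σ) xs) (map-id xs))

  infix 4 _∼[_]_
  -- Equality of types of enumerated tuples, as in `SameType`, but over an arbitrary enumerated base
  -- and with the inverse automorphism at hand.
  record _∼[_]_ {i j} {I : Set i} {J : Set j} (a : I → U) (c : J → U) (b : I → U) : Set (suc ℓ ⊔ i ⊔ j) where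
    constructor conj
    field
      aut   : Aut
      fixes : ∀ j → to aut (c j) ≡ c j
      maps  : ∀ i → to aut (a i) ≡ b i
  open _∼[_]_

  module _ {i j} {I : Set i} {J : Set j} where

    ∼-sym : {a b : I → U} {c : J → U} → a ∼[ c ] b → b ∼[ c ] a
    ∼-sym (conj σ f m) = conj (σ ⁻¹)
      (λ j → trans (cong (from σ) (sym (f j))) (from-to σ _))
      (λ i → trans (cong (from σ) (sym (m i))) (from-to σ _))

    ∼-trans : {a b d : I → U} {c : J → U} → a ∼[ c ] b → b ∼[ c ] d → a ∼[ c ] d
    ∼-trans (conj σ f m) (conj τ g n) = conj (τ ∘ᴬ σ)
      (λ j → trans (cong (to τ) (f j)) (g j)) (λ i → trans (cong (to τ) (m i)) (n i))

    ∼-resp : {a b a′ b′ : I → U} {c : J → U} → a ≗ a′ → b ≗ b′ → a ∼[ c ] b → a′ ∼[ c ] b′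
    ∼-resp p q (conj σ f m) = conj σ f (λ i → trans (cong (to σ) (sym (p i))) (trans (m i) (q i)))

    ∼-reindex : ∀ {i′} {I′ : Set i′} {a b : I → U} {c : J → U} (x : I′ → I) →
                a ∼[ c ] b → a ∘ x ∼[ c ] b ∘ x
    ∼-reindex x (conj σ f m) = conj σ f (m ∘ x)

    ∼-base : ∀ {j′} {J′ : Set j′} {a b : I → U} {c : J → U} {c′ : J′ → U} →
             (∀ j′ → ∃[ j ] c j ≡ c′ j′) → a ∼[ c ] b → a ∼[ c′ ] b
    ∼-base sub (conj σ f m) = conj σ
      (λ j′ → let (j , e) = sub j′ in trans (cong (to σ) (sym e)) (trans (f j) e)) m

  ∼-join : ∀ {i j k} {I : Set i} {J : Set j} {K : Set k} {a b : I → U} {c : J → U} {d : K → U} →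
           a ∼[ [ c , d ]′ ] b → [ a , c ]′ ∼[ d ] [ b , c ]′
  ∼-join (conj σ f m) = conj σ (f ∘ inj₂) λ { (inj₁ i) → m i ; (inj₂ j) → f (inj₁ j) }

  ∼-split : ∀ {i j k} {I : Set i} {J : Set j} {K : Set k} {a b : I → U} {c : J → U} {d : K → U} →
            [ a , c ]′ ∼[ d ] [ b , c ]′ → a ∼[ [ c , d ]′ ] b
  ∼-split (conj σ f m) = conj σ [ m ∘ inj₂ , f ] (m ∘ inj₁)

  ∼-joinʳ : ∀ {i j k} {I : Set i} {J : Set j} {K : Set k} {b b′ : I → U} {c : J → U} {d : K → U} →
            b ∼[ [ c , d ]′ ] b′ → [ c , b ]′ ∼[ d ] [ c , b′ ]′
  ∼-joinʳ (conj σ f m) = conj σ (f ∘ inj₂) λ { (inj₁ j) → f (inj₁ j) ; (inj₂ i) → m i }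

  infix 4 _≼_
  record _≼_ (M N : Model 𝔐) : Set (suc ℓ) where
    constructor strongly
    field
      strongIn : _≺_ 𝔐 M N

    embed : ∣ str M ∣ → ∣ str N ∣
    embed = proj₁ strongIn

    embed-strong : Strong (str M) (str N) embed
    embed-strong = proj₁ (proj₂ strongIn)

    embed-incl : ∀ x → incl N (embed x) ≡ incl M x
    embed-incl = proj₂ (proj₂ strongIn)
  open _≼_

  ι-injective : ∀ i {x y} → ι i x ≡ ι i y → x ≡ y
  ι-injective i = IsEmbedding.injective (ι-embedding i)

  incl-injective : ∀ M {x y} → incl M x ≡ incl M y → x ≡ y
  incl-injective M e = IsEmbedding.injective (strong-embedding (strong M)) (ι-injective (level M) e)

  idStrong : ∀ {M} → K M → Strong M M id
  idStrong {M} KM = strong-iso KM (record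
    { injective = id
    ; fun-homo = λ s xs → cong (Structure.fun M s) (sym (map-id xs))
    ; rel-iff = λ s xs → subst (λ ys → Structure.rel M s xs ⇔ Structure.rel M s ys) (sym (map-id xs)) (mk⇔ id id) }
    , λ y → y , λ e → e)

  InLevel : ∀ {M : Structure L ℓ} → (∣ M ∣ → U) → Ord → Set (suc ℓ)
  InLevel {M} u k = Σ[ g ∈ (∣ M ∣ → ∣ ℭᵢ k ∣) ] (Strong M (ℭᵢ k) g × ι k ∘ g ≗ u)

  abstract
    raise : ∀ M {k} → level M ≤ k → InLevel {str M} (incl M) k
    raise M (inj₂ refl) = into M , strong M , λ _ → refl
    raise M (inj₁ l<k) with increasing _ _ l<k
    ... | f , sf , e = f ∘ into M , strong-trans (strong M) sf , λ x → e (into M x)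

    -- Both models are strong in a common level of the monster, where coherence applies. Hence ≺
    -- between submodels of the monster is plain inclusion.
    ⊆⇒≼ : ∀ M N → (∀ x → ∃[ y ] incl N y ≡ incl M x) → M ≼ N
    ⊆⇒≼ M N sub =
      let k = level M ⊔′ level N
          (g , sg , eg) = raise M {k} (≤⊔ˡ _ _)
          (h , sh , eh) = raise N {k} (≤⊔ʳ _ _)
          f = proj₁ ∘ sub
          g≗hf = λ x → ι-injective k (trans (eg x) (trans (sym (proj₂ (sub x))) (sym (eh (f x)))))
      in strongly (f , coherence sh (strong-resp-≗ g≗hf sg) , proj₂ ∘ sub)

  ≼-refl : ∀ {M} → M ≼ M
  ≼-refl {M} = ⊆⇒≼ M M λ x → x , refl

  ≼-trans : ∀ {M N P} → M ≼ N → N ≼ P → M ≼ P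
  ≼-trans {M} {N} {P} p q = ⊆⇒≼ M P λ x →
    embed q (embed p x) , trans (embed-incl q _) (embed-incl p x)

  embed↣ : ∀ {M N} → M ≼ N → ∣ str M ∣ ↣ ∣ str N ∣
  embed↣ p = mk↣ (IsEmbedding.injective (strong-embedding (embed-strong p)))

  levelModel : Ord → Model 𝔐
  levelModel i = record { str = ℭᵢ i ; level = i ; into = id ; strong = idStrong (in-K i) }

  ι-mono : ∀ {i j} → i ≤ j → ∀ x → ∃[ y ] ι j y ≡ ι i x
  ι-mono (inj₂ refl) x = x , refl
  ι-mono (inj₁ i<j) x = let (f , _ , e) = increasing _ _ i<j in f x , e x

  level-of : U → Ord
  level-of c = proj₁ (union c)

  ∈level : ∀ c {k} → level-of c ≤ k → ∃[ x ] ι k x ≡ c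
  ∈level c p = let (i , x , e) = union c ; (y , e′) = ι-mono p x in y , trans e′ e

  abstract
    containing : (X : Set ℓ) (a : X → U) → Σ[ M ∈ Model 𝔐 ] (∀ x → ∃[ y ] incl M y ≡ a x)
    containing X a = let (k , <k) = small-bounded X (level-of ∘ a)
      in levelModel k , λ x → ∈level (a x) (inj₁ (<k x))

  -- An automorphism σ of ℭ preserves ℭ_k for cofinally many k, so that it maps
  -- submodels to submodels.

  module _ (σ : Aut) (i₀ : Ord) where

    private
      next : ∀ i → ∃[ j ] (i < j × (∀ x → level-of (to σ (ι i x)) < j) × (∀ x → level-of (from σ (ι i x)) < j))
      next i = let (j , p) = small-bounded (⊤ {ℓ} ⊎ (∣ ℭᵢ i ∣ ⊎ ∣ ℭᵢ i ∣))
                     [ (λ _ → i) , [ level-of ∘ to σ ∘ ι i , level-of ∘ from σ ∘ ι i ]′ ]′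
        in j , p (inj₁ tt) , p ∘ inj₂ ∘ inj₁ , p ∘ inj₂ ∘ inj₂

      stage : ℕ → Ord
      stage ℕ.zero = i₀
      stage (ℕ.suc n) = proj₁ (next (stage n))

      stage< : ∀ n → stage n < stage (ℕ.suc n)
      stage< n = proj₁ (proj₂ (next (stage n)))

    abstract
      closed-level : ∃[ k ] (i₀ < k × (∀ x → ∃[ y ] ι k y ≡ to σ (ι k x)) × (∀ x → ∃[ y ] ι k y ≡ from σ (ι k x)))
      -- `k` is the least upper bound of the ω many stages, hence a limit. By continuity every point
      -- of level `k` appears by some stage, and the following stage catches its images under σ and
      -- its inverse.
      closed-level with least wellFounded (λ k → ∀ n → stage n < k)
                          (let (b , p) = small-bounded (Lift ℓ ℕ) (stage ∘ lower) in b , p ∘ lift)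
      ... | k , above , min = k , above 0
          , closed (to σ) (λ n x → proj₁ (proj₂ (proj₂ (next (stage n)))) x)
          , closed (from σ) (λ n x → proj₂ (proj₂ (proj₂ (next (stage n)))) x)
        where
        below : ∀ {j} → j < k → ∃[ n ] j < stage n
        below {j} j<k = let (n , ≮) = ¬∀⇒∃ (min j j<k) in ℕ.suc n , ≤-<-trans (≮⇒≥ ≮) (stage< n)
        limit : IsLimit k
        limit = (i₀ , above 0) , λ j j<k → let (n , p) = below j<k in stage n , p , above n
        closed : (f : U → U) → (∀ n x → level-of (f (ι (stage n) x)) < stage (ℕ.suc n)) →
                 ∀ x → ∃[ y ] ι k y ≡ f (ι k x)
        closed f into-next x =
          let (j , j<k , y , e) = continuous k limit x
              (n , j<n) = below j<k
              (z , e′) = ι-mono (inj₁ j<n) y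
          in ∈level (f (ι k x)) (inj₁ (<-trans
               (subst (λ c → level-of (f c) < stage (ℕ.suc n)) (trans e′ e) (into-next n z))
               (above (ℕ.suc n))))

  iso-restrict : ∀ {k} (σ : Aut) → (∀ x → ∃[ y ] ι k y ≡ to σ (ι k x)) → (∀ x → ∃[ y ] ι k y ≡ from σ (ι k x)) →
    Σ[ f ∈ (∣ ℭᵢ k ∣ → ∣ ℭᵢ k ∣) ] (Strong (ℭᵢ k) (ℭᵢ k) f × ∀ x → ι k (f x) ≡ to σ (ι k x))
  iso-restrict {k} σ fwd bwd = f , strong-iso (in-K k) (embedding , surjective) , f-spec
    where
    f = proj₁ ∘ fwd
    f-spec = proj₂ ∘ fwd
    module σ = IsEmbedding (proj₁ (iso σ))
    module E = IsEmbedding (ι-embedding k)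
    maps-f : ∀ {n} (xs : Vec ∣ ℭᵢ k ∣ n) → map (ι k) (map f xs) ≡ map (to σ) (map (ι k) xs)
    maps-f xs = trans (sym (map-∘ _ _ xs)) (trans (map-cong f-spec xs) (map-∘ _ _ xs))
    embedding : IsEmbedding (ℭᵢ k) (ℭᵢ k) f
    embedding = record
      { injective = λ {x} {y} e → E.injective (σ.injective (trans (sym (f-spec x)) (trans (cong (ι k) e) (f-spec y))))
      ; fun-homo = λ s xs → E.injective (trans (f-spec _) (trans (cong (to σ) (E.fun-homo s xs))
          (trans (σ.fun-homo s _) (trans (cong (Structure.fun ℭ s) (sym (maps-f xs))) (sym (E.fun-homo s _))))))
      ; rel-iff = λ s xs → mk⇔
          (λ r → Equivalence.from (E.rel-iff s _) (subst (Structure.rel ℭ s) (sym (maps-f xs))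
                   (Equivalence.to (σ.rel-iff s _) (Equivalence.to (E.rel-iff s xs) r))))
          (λ r → Equivalence.from (E.rel-iff s xs) (Equivalence.from (σ.rel-iff s _)
                   (subst (Structure.rel ℭ s) (maps-f xs) (Equivalence.to (E.rel-iff s _) r)))) }
    surjective : Surjective _≡_ _≡_ f
    surjective y = let (x , e) = bwd y in
      x , λ { refl → E.injective (trans (f-spec x) (trans (cong (to σ) e) (to-from σ _))) }

  abstract
    image-model : ∀ σ M → Σ[ M′ ∈ Model 𝔐 ] Σ[ h ∈ (∣ str M ∣ → ∣ str M′ ∣) ]
      ((∀ x → incl M′ (h x) ≡ to σ (incl M x)) × (∀ y → ∃[ x ] h x ≡ y))
    image-model σ M = from-level (closed-level σ (level M))
      where
      from-level : ∃[ k ] (level M < k × (∀ x → ∃[ y ] ι k y ≡ to σ (ι k x)) × (∀ x → ∃[ y ] ι k y ≡ from σ (ι k x))) →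
        Σ[ M′ ∈ Model 𝔐 ] Σ[ h ∈ (∣ str M ∣ → ∣ str M′ ∣) ]
          ((∀ x → incl M′ (h x) ≡ to σ (incl M x)) × (∀ y → ∃[ x ] h x ≡ y))
      from-level (k , l<k , fwd , bwd) =
        let (g , sg , eg) = raise M {k} (inj₁ l<k)
            (f , sf , ef) = iso-restrict {k} σ fwd bwd
        in record { str = str M ; level = k ; into = f ∘ g ; strong = strong-trans sg sf } , id ,
           (λ x → trans (ef (g x)) (cong (to σ) (eg x))) , λ y → y , refl

  abstract
    hull : ∀ N (X : Set ℓ) (s : X → ∣ str N ∣) →
      Σ[ M ∈ Model 𝔐 ] (M ≼ N × (∀ x → ∃[ y ] incl M y ≡ incl N (s x)) × (∣ str M ∣ ↣ (X ⊎ ∣ LS ∣ᶜ)))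
    hull N X s with proj₂ (proj₂ hasLS) (str N) (strong-dom (strong N)) (λ x → Holds ℓ (∃[ i ] s i ≡ x))
    ... | M , f , sf , covers , M≤ =
      record { str = M ; level = level N ; into = into N ∘ f ; strong = strong-trans sf (strong N) } ,
      strongly (f , sf , λ _ → refl) ,
      (λ x → let (y , e) = covers (s x) (holds (x , refl)) in y , cong (incl N) e) ,
      (record { to = id ; cong = Pointwise-≡⇒≡ ; injective = ≡⇒Pointwise-≡ } ⊙ ((elements≤X ⊎-injection id≤) ⊙ M≤))
      where
      A : Pred ∣ str N ∣ ℓ
      A x = Holds ℓ (∃[ i ] s i ≡ x)
      id≤ : Cardinal.size LS ≤# Cardinal.size LS
      id≤ = mk↣ id
      elements≤X : elements A ≤# setoid X
      elements≤X = record
        { to = λ (x , h) → proj₁ (witness h)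
        ; cong = λ {p} {q} e → cong (λ (x , h) → proj₁ (witness h)) (Sub-≡ {x = p} {q} e)
        ; injective = λ {p} {q} e → trans (sym (proj₂ (witness (proj₂ p)))) (trans (cong s e) (proj₂ (witness (proj₂ q)))) }

-- Types and coheirs of enumerated families

module CoheirTheory (lem : ∀ {a} → ExcludedMiddle a) (ext : ∀ {a b} → Extensionality a b)
  {ℓ : Level} {L : Signature ℓ} {𝒦 : AEC L} (𝔐 : Monster 𝒦) (κ : Cardinal ℓ) (regular : Regular κ)
  (LS<κ : Cardinal.size (AEC.LS 𝒦) <# Cardinal.size κ)
  (tame : FullyTame 𝔐 κ) (short : FullyShort 𝔐 κ) (noOrder : ¬ WeakOrderProperty 𝔐 κ) where
  open Classical lem ext
  open Cardinals lem ext
  open Smallness κ regular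
  open MonsterModel lem ext 𝔐
  open Cardinal κ using (_<_; _≤_; Segment; size; wellFounded) renaming (Carrier to k)
  open Model {𝔐 = 𝔐}
  open Aut
  open _≼_

  ∼⇒SameType : ∀ {i} {I : Set i} {M} {a b : I → U} → a ∼[ incl M ] b → SameType 𝔐 M a b
  ∼⇒SameType (conj σ f m) = to σ , record
    { automorphism = iso σ
    ; fixes = λ { _ (x , refl) → f x }
    ; maps = λ i → (λ { (_ , refl) → tt , sym (m i) }) , λ { (_ , refl) → tt , m i } }

  SameType⇒∼ : ∀ {i} {I : Set i} M (a b : I → U) → SameType 𝔐 M a b → a ∼[ incl M ] b
  SameType⇒∼ M a b (f , p) = conj (toAut f automorphism) (λ x → fixes _ (x , refl))
    λ i → sym (proj₂ (proj₁ (maps i) (tt , refl)))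
    where open _∶_≡[_]_ p

  locally⇒globally : ∀ {I : Set ℓ} {a b : I → U} {M} →
    (∀ {X : Set ℓ} → IsSmall X → (x : X → I) → ∀ M₀ → M₀ ≼ M → IsSmall ∣ str M₀ ∣ →
      a ∘ x ∼[ incl M₀ ] b ∘ x) →
    a ∼[ incl M ] b
  locally⇒globally {I} {a} {b} {M} local = by-contradiction λ ≁ →
    let (I₀ , I₀<κ , ≁₀) = short I a b M (≁ ∘ SameType⇒∼ M a b)
        (M₀ , M₀≺M , M₀<κ , ≁₁) = tame (∃ I₀) (a ∘ proj₁) (b ∘ proj₁) M ≁₀
        (X , r , small , covers) = small-representatives (elements I₀) (proj₂ I₀<κ)
    in ≁₁ (∼⇒SameType {M = M₀} (cover I₀ X r covers {M₀} (local small (λ x → proj₁ (r x)) M₀ (strongly M₀≺M) (proj₂ M₀<κ))))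
    where
    -- `I₀` may be proof-relevant, so `∃ I₀` can be large although it has few elements. Agreement on
    -- representatives suffices, because a and b see only the underlying index.
    cover : ∀ (I₀ : Pred I ℓ) (X : Set ℓ) (r : X → ∃ I₀) → ((z : ∃ I₀) → ∃[ x ] proj₁ (r x) ≡ proj₁ z) → ∀ {M₀} →
            a ∘ proj₁ ∘ r ∼[ incl M₀ ] b ∘ proj₁ ∘ r → a ∘ proj₁ ∼[ incl M₀ ] b ∘ proj₁
    cover I₀ X r covers p = ∼-resp (λ z → cong a (proj₂ (covers z))) (λ z → cong b (proj₂ (covers z)))
                              (∼-reindex (proj₁ ∘ covers) p)

  small-hull : ∀ N {X : Set ℓ} → IsSmall X → (s : X → ∣ str N ∣) →
    Σ[ M ∈ Model 𝔐 ] (M ≼ N × (∀ x → ∃[ y ] incl M y ≡ incl N (s x)) × IsSmall ∣ str M ∣)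
  small-hull N {X} small s =
    let (M , M≼N , covers , M≤) = hull N X s in M , M≼N , covers , small-≤ M≤ (small-⊎ small (proj₂ LS<κ))

  small-submodel : ∀ M → Σ[ M₀ ∈ Model 𝔐 ] (M₀ ≼ M × IsSmall ∣ str M₀ ∣)
  small-submodel M = let (M₀ , M₀≼M , _ , small) = small-hull M (small-≤ none small-⊤) (λ ()) in M₀ , M₀≼M , small
    where
    none : Lift ℓ ⊥ ↣ ⊤ {ℓ}
    none = mk↣ {to = λ ()} λ {}

  -- Small parts are given by reindexings from small types, and the realisation in M is enumerated
  -- by the same X, so that it matches the part of a entry by entry.
  record Coh {i j} {I : Set i} {J : Set j} (a : I → U) (M : Model 𝔐) (c : J → U) : Set (suc ℓ ⊔ i ⊔ j) where
    constructor coh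
    field
      realise : ∀ {X Y : Set ℓ} → IsSmall X → IsSmall Y → (x : X → I) (y : Y → J) →
                ∃[ a′ ] (incl M ∘ a′) ∼[ c ∘ y ] (a ∘ x)
  open Coh

  Coh-mono : ∀ {i j i′ j′} {I : Set i} {J : Set j} {I′ : Set i′} {J′ : Set j′}
    {a : I → U} {c : J → U} {a′ : I′ → U} {c′ : J′ → U} {M} →
    (∀ i′ → ∃[ i ] a i ≡ a′ i′) → (∀ j′ → ∃[ j ] c j ≡ c′ j′) → Coh a M c → Coh a′ M c′
  Coh-mono sub-a sub-c h = coh λ small-X small-Y x y →
    let (a″ , p) = realise h small-X small-Y (proj₁ ∘ sub-a ∘ x) (proj₁ ∘ sub-c ∘ y)
    in a″ , ∼-resp (λ _ → refl) (λ i → proj₂ (sub-a (x i))) (∼-base (λ j → j , proj₂ (sub-c (y j))) p)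

  Coh-conj : ∀ {i j} {I : Set i} {J : Set j} {a a′ : I → U} {c c′ : J → U} {M} →
    [ a , c ]′ ∼[ incl M ] [ a′ , c′ ]′ → Coh a M c → Coh a′ M c′
  Coh-conj {M = M} (conj σ f m) h = coh λ small-X small-Y x y →
    let (a″ , conj τ g n) = realise h small-X small-Y x y
    -- Since σ fixes M pointwise, the same realisation in M serves again, with the automorphism
    -- conjugated by σ.
    in a″ , conj (σ ∘ᴬ τ ∘ᴬ σ ⁻¹)
      (λ j → let e = m (inj₂ (y j)) in
        trans (cong (to σ ∘ to τ) (trans (cong (from σ) (sym e)) (from-to σ _))) (trans (cong (to σ) (g j)) e))
      (λ i → trans (cong (to σ ∘ to τ) (trans (cong (from σ) (sym (f (a″ i)))) (from-to σ _)))
        (trans (cong (to σ) (n i)) (m (inj₁ (x i)))))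

  -- As LS(K) < κ, a small part of N lies in a small submodel of N. The automorphism that takes the
  -- set B⁻ onto A⁻ then pulls the enumeration of A⁻ back into M.
  coheir⇒Coh : ∀ A M N → Coheir 𝔐 κ A M N → Coh (SmallSet.elem A) M (incl N)
  coheir⇒Coh A M N (_ , h) = coh realise′
    where
    open SmallSet
    realise′ : ∀ {X Y : Set ℓ} → IsSmall X → IsSmall Y → (x : X → Index A) (y : Y → ∣ str N ∣) →
               ∃[ a′ ] (incl M ∘ a′) ∼[ incl N ∘ y ] (elem A ∘ x)
    realise′ {X} {Y} small-X small-Y x y = proj₁ ∘ preimage , conj (toAut f automorphism)
        (λ j → fixes _ (covers j))
        (λ i → let (m , z , e , e′) = preimage i in trans (cong f e) e′)
      where
      N⁻-spec = small-hull N small-Y y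
      N⁻ = proj₁ N⁻-spec
      covers = proj₁ (proj₂ (proj₂ N⁻-spec))
      A⁻ : Subset 𝔐
      A⁻ = range (elem A ∘ x)
      small-A⁻ : ¬ (size ≤# (#_ A⁻))
      small-A⁻ j = small-X (mk↣ {to = Injection.to j} λ e → Injection.injective j (cong (elem A ∘ x) e))
      B⁻-spec = h A⁻ N⁻ (λ { (z , refl) → x z , refl }) (≰⇒<# κ _ small-A⁻)
                  (strongIn (proj₁ (proj₂ N⁻-spec))) (≰⇒<# κ _ (proj₂ (proj₂ (proj₂ N⁻-spec))))
      B⁻ = proj₁ B⁻-spec
      f = proj₁ (proj₂ (proj₂ B⁻-spec))
      open _∶_≡[_]_ (proj₂ (proj₂ (proj₂ B⁻-spec)))
      preimage : ∀ i → ∃[ m ] ∃[ z ] (incl M m ≡ elem B⁻ z × f (elem B⁻ z) ≡ elem A (x i))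
      preimage i =
        let (z , e) = proj₂ (maps tt) (i , refl)
            (m , e′) = proj₁ (proj₂ B⁻-spec) (z , refl)
        in m , z , e′ , e

  Coh⇒coheir : ∀ A M N → M ≼ N → Coh (SmallSet.elem A) M (incl N) → Coheir 𝔐 κ A M N
  Coh⇒coheir A M N M≼N h = strongIn M≼N , λ A⁻ N⁻ A⁻⊆A A⁻<κ N⁻≺N N⁻<κ →
    let (X , r , small-X , covers) = small-representatives (#_ A⁻) (proj₂ A⁻<κ)
        x = λ i → proj₁ (A⁻⊆A (r i , refl))
        x-spec = λ i → proj₂ (A⁻⊆A (r i , refl))
        N⁻≼N = strongly {N⁻} {N} N⁻≺N
        (a′ , conj σ f m) = realise h small-X (proj₂ N⁻<κ) x (embed N⁻≼N)
    in range (incl M ∘ a′) , (λ { (i , refl) → a′ i , refl }) , to σ , record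
      { automorphism = iso σ
      ; fixes = λ { _ (y , refl) → trans (cong (to σ) (sym (embed-incl N⁻≼N y))) (trans (f y) (embed-incl N⁻≼N y)) }
      ; maps = λ _ → (λ { (i , refl) → r i , trans (sym (x-spec i)) (sym (m i)) })
                   , λ { (z , refl) → let (i , e) = covers z in i , trans (m i) (trans (x-spec i) e) } }

  -- Symmetry from the failure of the order property

  order-lemma : ∀ {X Y : Set ℓ} → IsSmall X → IsSmall Y → ∀ {M} → IsSmall ∣ str M ∣ →
    {p q : X ⊎ Y → U} (a : k → X → U) (b : k → Y → U) →
    (∀ i j → i ≤ j → [ a i , b j ]′ ∼[ incl M ] p) →
    (∀ i j → j < i → [ a i , b j ]′ ∼[ incl M ] q) →
    p ∼[ incl M ] q
  order-lemma small-X small-Y {M} small-M {p} {q} a b up down =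
    -- The order property wants tuples indexed by segments of κ. Enumerations with repetitions are
    -- enough, as types pass back and forth along the surjections `g` and `h`.
    let (α , g , g-onto) = small⇒segment small-X
        (β , h , h-onto) = small⇒segment small-Y
        gh = Sum.map g h
        cover = λ z → [ (λ x → inj₁ (proj₁ (g-onto x))) , (λ y → inj₂ (proj₁ (h-onto y))) ]′ z
        cover-spec = [ (λ x → cong inj₁ (proj₂ (g-onto x))) , (λ y → cong inj₂ (proj₂ (h-onto y))) ]
        split = λ i j → [ (λ _ → refl) , (λ _ → refl) ]
    in by-contradiction λ p≁q → noOrder record
      { α = α ; β = β ; M = M ; M-small = ≰⇒<# κ _ small-M
      ; p = p ∘ gh ; q = q ∘ gh
      ; p≢q = λ same → p≁q (∼-resp (λ z → cong p (cover-spec z)) (λ z → cong q (cover-spec z))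
                               (∼-reindex cover (SameType⇒∼ M (p ∘ gh) (q ∘ gh) same)))
      ; a = λ i → a i ∘ g ; b = λ j → b j ∘ h
      ; ordered = λ i j i≤j → ∼⇒SameType {M = M} (∼-resp (split i j) (λ _ → refl) (∼-reindex gh (up i j i≤j)))
      ; disordered = λ i j j<i → ∼⇒SameType {M = M} (∼-resp (split i j) (λ _ → refl) (∼-reindex gh (down i j j<i))) }

  module _ {X Y : Set ℓ} (small-X : IsSmall X) (small-Y : IsSmall Y) {M M₀ : Model 𝔐} (M₀≼M : M₀ ≼ M)
    (small-M₀ : IsSmall ∣ str M₀ ∣) {a : X → U} {b b* : Y → U} where

    private
      P : Set ℓ
      P = (X → ∣ str M ∣) × (Y → ∣ str M ∣)

      Earlier : k → Set ℓ
      Earlier i = ∀ j → j < i → P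

      paramsᵃ : ∀ i → Earlier i → ∣ str M₀ ∣ ⊎ (Y ⊎ (Segment i × Y)) → ∣ str M ∣ ⊎ Y
      paramsᵃ i rec = [ inj₁ ∘ embed M₀≼M , [ inj₂ , (λ ((j , j<i) , y) → inj₁ (proj₂ (rec j j<i) y)) ]′ ]′

      -- Here the current a_i is among the parameters, whereas `paramsᵃ` has only earlier b_j. This
      -- puts the diagonal i = j on the side of i ≤ j.
      paramsᵇ : ∀ i → Earlier i → (X → ∣ str M ∣) → ∣ str M₀ ∣ ⊎ (X ⊎ (X ⊎ (Segment i × X))) → ∣ str M ∣ ⊎ X
      paramsᵇ i rec aᵢ = [ inj₁ ∘ embed M₀≼M , [ inj₂ , [ inj₁ ∘ aᵢ , (λ ((j , j<i) , x) → inj₁ (proj₁ (rec j j<i) x)) ]′ ]′ ]′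

      Next : ∀ i → Earlier i → P → Set (suc ℓ)
      Next i rec (aᵢ , bᵢ) = ((incl M ∘ aᵢ) ∼[ [ incl M , b ]′ ∘ paramsᵃ i rec ] a)
                           × ((incl M ∘ bᵢ) ∼[ [ incl M , a ]′ ∘ paramsᵇ i rec aᵢ ] b*)

    small-symmetry : Coh a M [ incl M , b ]′ → Coh b* M [ incl M , a ]′ → b* ∼[ incl M ] b →
                     [ a , b ]′ ∼[ incl M₀ ] [ a , b* ]′
    small-symmetry coh-a coh-b* b*∼b = order-lemma small-X small-Y {M₀} small-M₀ A B up down
      where
      next : ∀ i rec → ∃[ p ] Next i rec p
      next i rec =
        let (aᵢ , p) = realise coh-a small-X
              (small-⊎ small-M₀ (small-⊎ small-Y (small-Σ (small-Segment i) λ _ → small-Y))) id (paramsᵃ i rec)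
            (bᵢ , q) = realise coh-b* small-Y
              (small-⊎ small-M₀ (small-⊎ small-X (small-⊎ small-X (small-Σ (small-Segment i) λ _ → small-X)))) id (paramsᵇ i rec aᵢ)
        in (aᵢ , bᵢ) , p , q
      chosen = wf-choice wellFounded {Q = Next} next
      A : k → X → U
      A i = incl M ∘ proj₁ (proj₁ chosen i)
      B : k → Y → U
      B i = incl M ∘ proj₂ (proj₁ chosen i)
      fromᵃ : ∀ {z} {Z : Set z} i {c : Z → U} →
              (∀ u → ∃[ v ] [ incl M , b ]′ (paramsᵃ i (λ j _ → proj₁ chosen j) v) ≡ c u) → A i ∼[ c ] a
      fromᵃ i sub = ∼-base sub (proj₁ (proj₂ chosen i))
      fromᵇ : ∀ {z} {Z : Set z} i {c : Z → U} →
              (∀ u → ∃[ v ] [ incl M , a ]′ (paramsᵇ i (λ j _ → proj₁ chosen j) (proj₁ (proj₁ chosen i)) v) ≡ c u) → B i ∼[ c ] b*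
      fromᵇ i sub = ∼-base sub (proj₂ (proj₂ chosen i))
      in-M : ∀ i → ∀ u → ∃[ v ] incl M v ≡ [ A i , incl M₀ ]′ u
      in-M i (inj₁ x) = _ , refl
      in-M i (inj₂ m) = embed M₀≼M m , embed-incl M₀≼M m
      up : ∀ i j → i ≤ j → [ A i , B j ]′ ∼[ incl M₀ ] [ a , b ]′
      -- a_i b_j ≡ a_i b* ≡ a_i b ≡ ab, where the middle step uses b* ≡_M b and that a_i lies in M.
      up i j i≤j = ∼-trans (∼-joinʳ (fromᵇ j (sub i≤j)))
        (∼-trans (∼-joinʳ (∼-base (in-M i) b*∼b))
                 (∼-join (fromᵃ i [ (λ y → inj₂ (inj₁ y) , refl) , (λ m → inj₁ m , embed-incl M₀≼M m) ])))
        where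
        sub : i ≤ j → ∀ u → ∃[ v ] [ incl M , a ]′ (paramsᵇ j (λ j _ → proj₁ chosen j) (proj₁ (proj₁ chosen j)) v) ≡ [ A i , incl M₀ ]′ u
        sub (inj₁ i<j)  (inj₁ x) = inj₂ (inj₂ (inj₂ ((i , i<j) , x))) , refl
        sub (inj₂ refl) (inj₁ x) = inj₂ (inj₂ (inj₁ x)) , refl
        sub _           (inj₂ m) = inj₁ m , embed-incl M₀≼M m
      down : ∀ i j → j < i → [ A i , B j ]′ ∼[ incl M₀ ] [ a , b* ]′
      -- a_i b_j ≡ a b_j ≡ ab*: the tuple b_j precedes a_i, and it was chosen over a.
      down i j j<i = ∼-trans
        (∼-join (fromᵃ i [ (λ y → inj₂ (inj₂ ((j , j<i) , y)) , refl) , (λ m → inj₁ m , embed-incl M₀≼M m) ]))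
        (∼-joinʳ (fromᵇ j [ (λ x → inj₂ (inj₁ x) , refl) , (λ m → inj₁ m , embed-incl M₀≼M m) ]))

  partition : ∀ {X I J : Set ℓ} → IsSmall X → (x : X → I ⊎ J) →
    Σ[ X₁ ∈ Set ℓ ] Σ[ X₂ ∈ Set ℓ ] Σ[ x₁ ∈ (X₁ → I) ] Σ[ x₂ ∈ (X₂ → J) ] Σ[ r ∈ (X → X₁ ⊎ X₂) ]
      (IsSmall X₁ × IsSmall X₂ × (∀ z → Sum.map x₁ x₂ (r z) ≡ x z))
  partition {X} {I} {J} small x =
    (∃[ z ] ∃[ i ] x z ≡ inj₁ i) , (∃[ z ] ∃[ j ] x z ≡ inj₂ j) , proj₁ ∘ proj₂ , proj₁ ∘ proj₂ , (λ z → side z (x z) refl) ,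
    small-≤ (mk↣ {to = proj₁} λ { {_ , _ , p} {_ , _ , q} refl → cong (_ ,_) (unique₁ p q) }) small ,
    small-≤ (mk↣ {to = proj₁} λ { {_ , _ , p} {_ , _ , q} refl → cong (_ ,_) (unique₂ p q) }) small ,
    λ z → side-spec z (x z) refl
    where
    unique₁ : ∀ {w i i′} (p : w ≡ inj₁ i) (q : w ≡ inj₁ i′) → (i , p) ≡ (i′ , q)
    unique₁ refl refl = refl
    unique₂ : ∀ {w j j′} (p : w ≡ inj₂ j) (q : w ≡ inj₂ j′) → (j , p) ≡ (j′ , q)
    unique₂ refl refl = refl
    side : ∀ z w → x z ≡ w → (∃[ z ] ∃[ i ] x z ≡ inj₁ i) ⊎ (∃[ z ] ∃[ j ] x z ≡ inj₂ j)
    side z (inj₁ i) e = inj₁ (z , i , e)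
    side z (inj₂ j) e = inj₂ (z , j , e)
    side-spec : ∀ z w (e : x z ≡ w) → Sum.map (proj₁ ∘ proj₂) (proj₁ ∘ proj₂) (side z w e) ≡ x z
    side-spec z (inj₁ i) e = sym e
    side-spec z (inj₂ j) e = sym e

  locally⇒globally₂ : ∀ {I J : Set ℓ} {a a′ : I → U} {b b′ : J → U} {M} →
    (∀ {X Y : Set ℓ} → IsSmall X → IsSmall Y → (x : X → I) (y : Y → J) → ∀ M₀ → M₀ ≼ M → IsSmall ∣ str M₀ ∣ →
      [ a ∘ x , b ∘ y ]′ ∼[ incl M₀ ] [ a′ ∘ x , b′ ∘ y ]′) →
    [ a , b ]′ ∼[ incl M ] [ a′ , b′ ]′
  locally⇒globally₂ {I} {J} {a} {a′} {b} {b′} {M} local = locally⇒globally {M = M} λ small z M₀ M₀≼M small-M₀ →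
    let (X , Y , x , y , r , small-X , small-Y , spec) = partition small z
    in ∼-resp (λ w → regroup x y (r w) (spec w)) (λ w → regroup x y (r w) (spec w))
         (∼-reindex r (local small-X small-Y x y M₀ M₀≼M small-M₀))
    where
    regroup : ∀ {X Y : Set ℓ} {a : I → U} {b : J → U} (x : X → I) (y : Y → J) w {v} → Sum.map x y w ≡ v →
              [ a ∘ x , b ∘ y ]′ w ≡ [ a , b ]′ v
    regroup x y (inj₁ _) refl = refl
    regroup x y (inj₂ _) refl = refl

  symmetry : ∀ {I J : Set ℓ} {a : I → U} {b b* : J → U} {M} →
    Coh a M [ incl M , b ]′ → Coh b* M [ incl M , a ]′ → b* ∼[ incl M ] b → [ a , b ]′ ∼[ incl M ] [ a , b* ]′
  symmetry {M = M} coh-a coh-b* b*∼b = locally⇒globally₂ {M = M} λ small-X small-Y x y M₀ M₀≼M small-M₀ →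
    small-symmetry small-X small-Y M₀≼M small-M₀
      (Coh-mono (λ i → x i , refl) [ (λ m → inj₁ m , refl) , (λ i → inj₂ (y i) , refl) ] coh-a)
      (Coh-mono (λ i → y i , refl) [ (λ m → inj₁ m , refl) , (λ i → inj₂ (x i) , refl) ] coh-b*)
      (∼-reindex y b*∼b)

  -- Coheirs do not split: a small part of b is conjugate over small parts of M, a and a′ to some b′
  -- in M, and a and a′ agree over b′.
  same-over : ∀ {I J : Set ℓ} {a a′ : I → U} {b : J → U} {M} →
    Coh b M [ incl M , [ a , a′ ]′ ]′ → a ∼[ incl M ] a′ → [ a , b ]′ ∼[ incl M ] [ a′ , b ]′
  same-over {a = a} {a′} {b} {M} coh-b a∼a′ = locally⇒globally₂ {M = M} λ {X} {Y} small-X small-Y x y M₀ M₀≼M small-M₀ →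
    let (b′ , p) = realise coh-b small-Y (small-⊎ small-M₀ (small-⊎ small-X small-X)) y
                     [ inj₁ ∘ embed M₀≼M , inj₂ ∘ Sum.map x x ]′
    in ∼-trans (∼-joinʳ (∼-sym (∼-base [ (λ i → inj₂ (inj₁ i) , refl) , (λ m → inj₁ m , embed-incl M₀≼M m) ] p)))
      (∼-trans (∼-join (∼-base [ (λ i → b′ i , refl) , (λ m → embed M₀≼M m , embed-incl M₀≼M m) ] (∼-reindex x a∼a′)))
               (∼-joinʳ (∼-base [ (λ i → inj₂ (inj₂ i) , refl) , (λ m → inj₁ m , embed-incl M₀≼M m) ] p)))

  -- Uniqueness, transitivity and symmetry from existence

  module Extension (E : PropertyE 𝔐 κ (Coheir 𝔐 κ)) where

    Coh-over-base : ∀ {I : Set ℓ} (a : I → U) {M} → Big 𝔐 κ M → Coh a M (incl M)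
    Coh-over-base a {M} big = coheir⇒Coh (range a) M M (proj₁ E (range a) M big)

    extend : ∀ {I : Set ℓ} {a : I → U} {M N N′} → Big 𝔐 κ M → M ≼ N → N ≼ N′ → Coh a M (incl N) →
      ∃[ a′ ] (a′ ∼[ incl N ] a × Coh a′ M (incl N′))
    extend {a = a} {M} {N} {N′} big M≼N N≼N′ h
      with proj₂ E (range a) M N N′ big (strongIn M≼N) (strongIn N≼N′) (Coh⇒coheir (range a) M N M≼N h)
    ... | A′ , (f , p) , q = (λ i → SmallSet.elem A′ (proj₁ (pre i))) ,
        conj (toAut f automorphism) (λ x → fixes _ (x , refl)) (λ i → proj₂ (pre i)) ,
        Coh-mono (λ i → proj₁ (pre i) , refl) (λ x → x , refl) (coheir⇒Coh A′ M N′ q)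
      where
      open _∶_≡[_]_ p
      pre : ∀ i → ∃[ z ] f (SmallSet.elem A′ z) ≡ a i
      pre i = proj₂ (maps tt) (i , refl)

    free : ∀ {I : Set ℓ} (a : I → U) {M N} → Big 𝔐 κ M → M ≼ N → ∃[ a′ ] (a′ ∼[ incl M ] a × Coh a′ M (incl N))
    free a big M≼N = extend big ≼-refl M≼N (Coh-over-base a big)

    unique : ∀ {I : Set ℓ} {a a′ : I → U} {M N} → Big 𝔐 κ M → M ≼ N →
      Coh a M (incl N) → Coh a′ M (incl N) → a ∼[ incl M ] a′ → a ∼[ incl N ] a′
    unique {I} {a} {a′} {M} {N} big M≼N coh-a coh-a′ a∼a′ =
      let (N* , covers) = containing (∣ str M ∣ ⊎ (I ⊎ I)) [ incl M , [ a , a′ ]′ ]′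
          (b* , b*∼b , coh-b*) = free (incl N) big (⊆⇒≼ M N* (covers ∘ inj₁))
          sym-a  = symmetry {M = M} (Coh-mono (λ i → i , refl) in-N coh-a)
                     (Coh-mono (λ i → i , refl) [ covers ∘ inj₁ , covers ∘ inj₂ ∘ inj₁ ] coh-b*) b*∼b
          sym-a′ = symmetry {M = M} (Coh-mono (λ i → i , refl) in-N coh-a′)
                     (Coh-mono (λ i → i , refl) [ covers ∘ inj₁ , covers ∘ inj₂ ∘ inj₂ ] coh-b*) b*∼b
          -- With b enumerating N, the chain is ab ≡ ab* ≡ a′b* ≡ a′b. The middle step needs one b*
          -- that is free from a and a′ together, hence the model `N*` containing both.
          middle = same-over {M = M} (Coh-mono (λ i → i , refl) covers coh-b*) a∼a′
      in ∼-base (λ x → inj₁ x , refl) (∼-split (∼-trans sym-a (∼-trans middle (∼-sym sym-a′))))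
      where
      in-N : ∀ u → ∃[ v ] incl N v ≡ [ incl M , incl N ]′ u
      in-N = [ (λ m → embed M≼N m , embed-incl M≼N m) , (λ n → n , refl) ]

    -- A failure is witnessed by a small A⁻ and a small N⁻ ≺ N. Any N₀ in the monster that contains
    -- N⁻ has it as a strong submodel, so the same pair refutes coheir over N₀.
    coheir-C : PropertyC 𝔐 κ (Coheir 𝔐 κ)
    coheir-C A M N _ M≺N ¬h = by-contradiction λ none → ¬h (M≺N , λ A⁻ N⁻ A⁻⊆A A⁻<κ N⁻≺N N⁻<κ →
      by-contradiction λ ¬B → none (A⁻ , universe N⁻ , (λ {x} → A⁻⊆A {x}) , A⁻<κ ,
        (λ { (y , refl) → embed (strongly {N⁻} {N} N⁻≺N) y , embed-incl (strongly {N⁻} {N} N⁻≺N) y }) ,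
        ≰⇒<# κ _ (λ j → proj₂ N⁻<κ (mk↣ {to = Injection.to j} λ e → Injection.injective j (cong (incl N⁻) e))) ,
        λ N₀ _ N⁻⊆N₀ h → ¬B (proj₂ h A⁻ N⁻ id A⁻<κ (strongIn (⊆⇒≼ N⁻ N₀ (λ y → N⁻⊆N₀ (y , refl)))) N⁻<κ)))

    coheir-T : PropertyT 𝔐 κ (Coheir 𝔐 κ)
    coheir-T M₀ M₁ M₂ N _ M₀≺M₁ _ h₁ h₂ =
      Coh⇒coheir (universe M₂) M₀ N (≼-trans {M₀} {M₁} {N} (strongly M₀≺M₁) (strongly (proj₁ h₂))) (coh λ small-X small-Y x y →
        let (a′ , p) = realise (coheir⇒Coh (universe M₂) M₁ N h₂) small-X small-Y x y
            (a″ , q) = realise (coheir⇒Coh (universe M₁) M₀ N h₁) small-X small-Y a′ y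
        in a″ , ∼-trans q p)

    Coh-base : ∀ {i j} {I : Set i} {J : Set j} {a : I → U} {c : J → U} {M M′} → M ≼ M′ → Coh a M c → Coh a M′ c
    Coh-base M≼M′ h = coh λ small-X small-Y x y →
      let (a′ , p) = realise h small-X small-Y x y
      in embed M≼M′ ∘ a′ , ∼-resp (λ i → sym (embed-incl M≼M′ (a′ i))) (λ _ → refl) p

    Coh-∼ : ∀ {i j} {I : Set i} {J : Set j} {a a′ : I → U} {c : J → U} {M} →
      a ∼[ c ] a′ → Coh a M c → Coh a′ M c
    Coh-∼ a∼a′ h = coh λ small-X small-Y x y →
      let (a″ , p) = realise h small-X small-Y x y
      in a″ , ∼-trans p (∼-reindex x (∼-base (λ j → y j , refl) a∼a′))

    -- Extend the type of A over M₁ to M₂, staying free over M₀. With the base raised to M₁,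
    -- uniqueness identifies this extension with A over M₂.
    coheir-T* : PropertyT* 𝔐 κ (Coheir 𝔐 κ)
    coheir-T* A M₀ M₁ M₂ big M₀≺M₁ M₁≺M₂ h₁ h₂ =
      let M₀≼M₁ = strongly {M₀} {M₁} M₀≺M₁
          M₁≼M₂ = strongly {M₁} {M₂} M₁≺M₂
          big₁ = embed↣ M₀≼M₁ ⊙ big
          (a′ , a′∼a , h) = extend big M₀≼M₁ M₁≼M₂ (coheir⇒Coh A M₀ M₁ h₁)
      in Coh⇒coheir A M₀ M₂ (≼-trans M₀≼M₁ M₁≼M₂)
           (Coh-∼ (unique big₁ M₁≼M₂ (Coh-base M₀≼M₁ h) (coheir⇒Coh A M₁ M₂ h₂) a′∼a) h)

    -- Enumerating A′ as `f ∘ elem A` makes the automorphism given by `unique` agree with `f` on A.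
    coheir-U : PropertyU 𝔐 κ (Coheir 𝔐 κ)
    coheir-U A A′ M N f big h h′ p = agree (unique {M = M} {N} big (strongly (proj₁ h)) (coheir⇒Coh A M N h)
        (Coh-mono covered (λ n → n , refl) (coheir⇒Coh A′ M N h′)) f-over-M)
      where
      open SmallSet
      open _∶_≡[_]_ p
      covered : ∀ i → ∃[ i′ ] elem A′ i′ ≡ f (elem A i)
      covered i = proj₁ (maps tt) (i , refl)
      f-over-M : elem A ∼[ incl M ] f ∘ elem A
      f-over-M = conj (toAut f automorphism) (λ x → fixes _ (x , refl)) (λ _ → refl)
      agree : elem A ∼[ incl N ] f ∘ elem A →
              ∃[ g ] (_∶_≡[_]_ 𝔐 g (one 𝔐 A) (universe N) (one 𝔐 A′) × (∀ x → x ∈ ⟪ A ⟫ → g x ≡ f x))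
      agree (conj σ g m) = to σ , record
          { automorphism = iso σ
          ; fixes = λ { _ (x , refl) → g x }
          ; maps = λ _ → (λ { (i , refl) → proj₁ (maps tt) (i , sym (m i)) })
                       , λ q → let (i , e) = proj₂ (maps tt) q in i , trans (m i) e }
        , λ { _ (i , refl) → m i }

    coheir-S : PropertyS 𝔐 κ (Coheir 𝔐 κ)
    coheir-S = (λ A M N big h → symmetric A M N big (strongly (proj₁ h)) (coheir⇒Coh A M N h)) ,
      λ A M N big M≺A h → restrict A M N (strongly M≺A)
        (symmetric (universe A) M N big (strongly (proj₁ h)) (coheir⇒Coh (universe A) M N h))
      where
      open SmallSet
      Swapped : Subset 𝔐 → Model 𝔐 → Model 𝔐 → Set (suc ℓ)
      Swapped A M N = Σ[ M′ ∈ Model 𝔐 ] (_≺_ 𝔐 M M′ × ⟪ A ⟫ ⊆ ⟪ universe M′ ⟫ × Coheir 𝔐 κ (universe N) M M′)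

      restrict : ∀ A M N → M ≼ A → Swapped (universe A) M N → Coheir 𝔐 κ (universe N) M A
      restrict A M N M≼A (M′ , _ , A⊆M′ , h) = Coh⇒coheir (universe N) M A M≼A
        (Coh-mono (λ i → i , refl) (λ x → A⊆M′ (x , refl)) (coheir⇒Coh (universe N) M M′ h))

      module _ (A : Subset 𝔐) (M N : Model 𝔐) (big : Big 𝔐 κ M) (M≼N : M ≼ N) (h : Coh (elem A) M (incl N)) where

        module _ (N* : Model 𝔐) (covers : ∀ u → ∃[ y ] incl N* y ≡ [ incl M , elem A ]′ u)
          {b* : ∣ str N ∣ → U} (b*∼b : b* ∼[ incl M ] incl N) (coh-b* : Coh b* M (incl N*)) where
          over-A : [ elem A , b* ]′ ∼[ incl M ] [ elem A , incl N ]′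
          over-A = ∼-sym (symmetry {M = M}
            (Coh-mono (λ i → i , refl) [ (λ m → embed M≼N m , embed-incl M≼N m) , (λ n → n , refl) ] h)
            (Coh-mono (λ i → i , refl) covers coh-b*) b*∼b)
          image-contains : ∀ {σ M′} (g : ∣ str N* ∣ → ∣ str M′ ∣) → (∀ x → incl M′ (g x) ≡ to σ (incl N* x)) →
            ∀ u {c} → to σ ([ incl M , elem A ]′ u) ≡ c → ∃[ y ] incl M′ y ≡ c
          image-contains {σ} g g-spec u e = g (proj₁ (covers u)) ,
            trans (g-spec _) (trans (cong (to σ) (proj₂ (covers u))) e)
          -- The automorphism fixes M and A pointwise and takes b* to N, so freeness of b* from `N*`
          -- becomes freeness of N from the image M′ of `N*`, which still contains M and A.
          move : (p : [ elem A , b* ]′ ∼[ incl M ] [ elem A , incl N ]′) → let σ = _∼[_]_.aut p in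
            Σ[ M′ ∈ Model 𝔐 ] Σ[ g ∈ (∣ str N* ∣ → ∣ str M′ ∣) ]
              ((∀ x → incl M′ (g x) ≡ to σ (incl N* x)) × (∀ y → ∃[ x ] g x ≡ y)) →
            Swapped A M N
          move (conj σ fixes maps) (M′ , g , g-spec , g-onto) = M′ , strongIn M≼M′ ,
              (λ { (i , refl) → image-contains {σ} {M′} g g-spec (inj₂ i) (maps (inj₁ i)) }) ,
              Coh⇒coheir (universe N) M M′ M≼M′ (Coh-mono (λ i → i , refl)
                (λ y → let (x , e) = g-onto y in x , trans (sym (g-spec x)) (cong (incl M′) e))
                (Coh-conj (conj σ fixes [ maps ∘ inj₂ , (λ _ → refl) ]) coh-b*))
            where
            M≼M′ : M ≼ M′
            M≼M′ = ⊆⇒≼ M M′ (λ m → image-contains {σ} {M′} g g-spec (inj₁ m) (fixes m))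

        symmetric : Swapped A M N
        symmetric = from-cover (containing _ [ incl M , elem A ]′)
          where
          from-free : ∀ N* (covers : ∀ u → ∃[ y ] incl N* y ≡ [ incl M , elem A ]′ u) →
            ∃[ b* ] (b* ∼[ incl M ] incl N × Coh b* M (incl N*)) → Swapped A M N
          from-free N* covers (b* , b*∼b , coh-b*) =
            let p = over-A N* covers b*∼b coh-b* in move N* covers b*∼b coh-b* p (image-model (_∼[_]_.aut p) N*)
          from-cover : Σ[ N* ∈ Model 𝔐 ] (∀ u → ∃[ y ] incl N* y ≡ [ incl M , elem A ]′ u) → Swapped A M N
          from-cover (N* , covers) = from-free N* covers (free (incl N) big (⊆⇒≼ M N* (covers ∘ inj₁)))

    -- Local character

    open SmallSet
    open WellOrderProperties (Cardinal.wellOrder κ) using (segment↣; ≤⊔ˡ; ≤⊔ʳ; _⊔′_)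

    module Union (N : Model 𝔐) (Nᵢ : k → Model 𝔐) (increasing : ∀ {i j} → i < j → Nᵢ i ≼ Nᵢ j)
      (Nᵢ≼N : ∀ i → Nᵢ i ≼ N) where

      private
        C : Set ℓ
        C = Sub ℓ (λ x → ∃[ i ] ∃[ y ] embed (Nᵢ≼N i) y ≡ x)

        u : ∀ i → ∣ str (Nᵢ i) ∣ → C
        u i y = embed (Nᵢ≼N i) y , holds (i , y , refl)

        lift-≤ : ∀ {i j} → i ≤ j → (y : ∣ str (Nᵢ i) ∣) → ∃[ z ] embed (Nᵢ≼N j) z ≡ embed (Nᵢ≼N i) y
        lift-≤ (inj₂ refl) y = y , refl
        lift-≤ (inj₁ i<j) y = embed (increasing i<j) y , incl-injective N
          (trans (embed-incl (Nᵢ≼N _) _) (trans (embed-incl (increasing i<j) y) (sym (embed-incl (Nᵢ≼N _) y))))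

        lift-≤s : ∀ {i j n} → i ≤ j → (ys : Vec ∣ str (Nᵢ i) ∣ n) →
                  ∃[ zs ] map (embed (Nᵢ≼N j)) zs ≡ map (embed (Nᵢ≼N i)) ys
        lift-≤s p [] = [] , refl
        lift-≤s p (y ∷ ys) = let (z , e) = lift-≤ p y ; (zs , es) = lift-≤s p ys in z ∷ zs , cong₂ _∷_ e es

        -- Arities are finite, so the arguments of a function lie in one stage; this closes the
        -- union under the functions of N.
        at-stage : ∀ {n} (xs : Vec C n) → ∃[ i ] ∃[ ys ] map (embed (Nᵢ≼N i)) ys ≡ map proj₁ xs
        at-stage [] = some , [] , refl
        at-stage ((x , h) ∷ xs) =
          let (i , y , e) = witness h ; (j , ys , es) = at-stage xs
              (z , e′) = lift-≤ (≤⊔ˡ i j) y ; (zs , es′) = lift-≤s (≤⊔ʳ i j) ys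
          in i ⊔′ j , z ∷ zs , cong₂ _∷_ (trans e′ e) (trans es′ es)

        S : Structure L ℓ
        S = record
          { Carrier = C
          ; fun = λ s xs → Structure.fun (str N) s (map proj₁ xs) , holds (value s xs (at-stage xs))
          ; rel = λ s xs → Structure.rel (str N) s (map proj₁ xs) }
          where
          value : ∀ s xs → ∃[ i ] ∃[ ys ] map (embed (Nᵢ≼N i)) ys ≡ map proj₁ xs →
                  ∃[ i ] ∃[ y ] embed (Nᵢ≼N i) y ≡ Structure.fun (str N) s (map proj₁ xs)
          value s xs (i , ys , es) = i , Structure.fun (str (Nᵢ i)) s ys ,
            trans (IsEmbedding.fun-homo (AEC.strong-embedding 𝒦 (embed-strong (Nᵢ≼N i))) s ys)
                  (cong (Structure.fun (str N) s) es)

        u-embedding : ∀ i → IsEmbedding (str (Nᵢ i)) S (u i)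
        u-embedding i = record
          { injective = λ e → E.injective (cong proj₁ e)
          ; fun-homo = λ s xs → Sub-≡ (trans (E.fun-homo s xs) (cong (Structure.fun (str N) s) (map-∘ _ _ xs)))
          ; rel-iff = λ s xs → subst (λ ys → Structure.rel (str (Nᵢ i)) s xs ⇔ Structure.rel (str N) s ys)
                                  (map-∘ _ _ xs) (E.rel-iff s xs) }
          where module E = IsEmbedding (AEC.strong-embedding 𝒦 (embed-strong (Nᵢ≼N i)))

        S-strong : AEC.Strong 𝒦 S (str N) proj₁
        S-strong = proj₂ (AEC.chain 𝒦 (Cardinal.wellOrder κ) (some , unbounded) (str ∘ Nᵢ) S u u-embedding
          (λ i j i<j → embed (increasing i<j) , embed-strong (increasing i<j) , λ y → Sub-≡ (proj₂ (lift-≤ (inj₁ i<j) y)))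
          (λ (x , h) → let (i , y , e) = witness h in i , y , Sub-≡ e))
          (str N) proj₁ (λ i → embed-strong (Nᵢ≼N i))

      union-model : Model 𝔐
      union-model = record { str = S ; level = level N ; into = into N ∘ proj₁ ; strong = AEC.strong-trans 𝒦 S-strong (strong N) }

      union≼N : union-model ≼ N
      union≼N = ⊆⇒≼ union-model N λ x → proj₁ x , refl

      Nᵢ≼union : ∀ i → Nᵢ i ≼ union-model
      Nᵢ≼union i = ⊆⇒≼ (Nᵢ i) union-model λ y → u i y , embed-incl (Nᵢ≼N i) y

      union-covered : ∀ x → ∃[ i ] ∃[ y ] incl (Nᵢ i) y ≡ incl union-model x
      union-covered (x , h) = let (i , y , e) = witness h in
        i , y , trans (sym (embed-incl (Nᵢ≼N i) y)) (cong (incl N) e)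

    spread : ∀ {b} {A : Set ℓ} {B : Set b} (j : A ↣ k) → (A → B) → B → k → B
    spread j f default i with lem {P = ∃[ x ] Injection.to j x ≡ i}
    ... | yes (x , _) = f x
    ... | no _        = default

    spread-to : ∀ {b} {A : Set ℓ} {B : Set b} (j : A ↣ k) (f : A → B) default x → spread j f default (Injection.to j x) ≡ f x
    spread-to j f default x with lem {P = ∃[ y ] Injection.to j y ≡ Injection.to j x}
    ... | yes (y , e) = cong f (Injection.injective j e)
    ... | no none     = contradiction (x , refl) none

    absurd : ∀ {b} {B : Set b} → Lift ℓ ⊥ → B
    absurd ()

    nothing : Lift ℓ ⊥ → U
    nothing = absurd

    small-⊥ : IsSmall (Lift ℓ ⊥)
    small-⊥ κ≤⊥ = absurd (Injection.to κ≤⊥ some)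

    realise-type : ∀ {I : Set ℓ} {J : Set ℓ} {a : I → U} {M} {c : J → U} → Coh a M c → IsSmall I →
      ∃[ a′ ] (incl M ∘ a′) ∼[ nothing ] a
    realise-type {c = c} h small =
      let (a′ , p) = realise h small small-⊥ id absurd in a′ , ∼-base {c = c ∘ absurd} (λ ()) p

    -- Types of small tuples are counted through their realisations in Mᵇ, so that
    -- the bound Z on the size of the submodel W of N does not depend on N.

    module Closure {α : Set ℓ} (Mᵇ : Model 𝔐) (bigᵇ : Big 𝔐 κ Mᵇ) where

      -- The sum of everything that Z has to dominate when the stages of W are counted.
      Vals : Set ℓ
      Vals = (α ⊎ ∣ str Mᵇ ∣) ⊎ (k ⊎ ∣ AEC.LS 𝒦 ∣ᶜ)

      open Hartogs lem ext using (module Powers)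
      open Powers κ regular Vals (inj₂ (inj₁ some)) (inj₂ (inj₁ other)) (some≢other ∘ inj₁-injective ∘ inj₂-injective) public

      α≤Z : α ↣ Z
      α≤Z = V≤Z ⊙ mk↣ {to = inj₁ ∘ inj₁} λ { refl → refl }
      Mᵇ≤Z : ∣ str Mᵇ ∣ ↣ Z
      Mᵇ≤Z = V≤Z ⊙ mk↣ {to = inj₁ ∘ inj₂} λ { refl → refl }
      k≤Z : k ↣ Z
      k≤Z = V≤Z ⊙ mk↣ {to = inj₂ ∘ inj₁} λ { refl → refl }
      LS≤Z : ∣ AEC.LS 𝒦 ∣ᶜ ↣ Z
      LS≤Z = V≤Z ⊙ mk↣ {to = inj₂ ∘ inj₂} λ { refl → refl }

      Σ≤Z : ∀ {i b} {I : Set i} {B : I → Set b} → I ↣ Z → (∀ i → B i ↣ Z) → Σ I B ↣ Z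
      Σ≤Z {I = I} {B} I≤Z B≤Z = (mk↣ {to = id} id ×ᶻ mk↣ {to = id} id) ⊙ mk↣ {to = code} λ {p} {q} → code-injective p q
        where
        code : Σ I B → Z × Z
        code (i , b) = Injection.to I≤Z i , Injection.to (B≤Z i) b
        code-injective : ∀ p q → code p ≡ code q → p ≡ q
        code-injective (i , b) (j , c) e with Injection.injective I≤Z (cong proj₁ e)
        ... | refl = cong (i ,_) (Injection.injective (B≤Z i) (cong proj₂ e))

      Segment≤Z : ∀ i → Segment i ↣ Z
      Segment≤Z i = k≤Z ⊙ segment↣

      module _ (N : Model 𝔐) (bigᴺ : Big 𝔐 κ N) (a : α → U) where

        P : Set (suc ℓ)
        P = Σ[ M ∈ Model 𝔐 ] (M ≼ N × (∣ str M ∣ ↣ Z))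

        Earlier : k → Set (suc ℓ)
        Earlier i = ∀ j → j < i → P

        module Stage (i : k) (rec : Earlier i) where

          Old : Set ℓ
          Old = Σ[ (j , j<i) ∈ Segment i ] ∣ str (proj₁ (rec j j<i)) ∣

          Params : Set ℓ
          Params = k ⊎ (Old ⊎ α)

          old : Old → ∣ str N ∣
          old ((j , j<i) , x) = embed (proj₁ (proj₂ (rec j j<i))) x

          point : Params → U
          point = [ incl N ∘ Injection.to bigᴺ , [ incl N ∘ old , a ]′ ]′

          -- A request (d , γ , t , t′) asks for a γ-tuple of N that relates to the parameters named
          -- by d as t relates to t′ in `Mᵇ`. Only values below γ matter, but total functions on κ
          -- let the requests be counted by κ-th powers.
          Request : Set ℓ
          Request = (k → Params) × (k × ((k → ∣ str Mᵇ ∣) × (k → ∣ str Mᵇ ∣)))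

          length : Request → k
          length (_ , γ , _) = γ

          wanted : (q : Request) → Segment (length q) → U
          wanted (d , _) s = point (d (proj₁ s))

          target : (q : Request) → Segment (length q) ⊎ Segment (length q) → U
          target (_ , _ , t , t′) = [ (λ s → incl Mᵇ (t (proj₁ s))) , (λ s → incl Mᵇ (t′ (proj₁ s))) ]′

          Answers : (q : Request) → (Segment (length q) → ∣ str N ∣) → Set (suc ℓ)
          Answers q b = [ incl N ∘ b , wanted q ]′ ∼[ nothing ] target q

          -- A request that N cannot meet gets an arbitrary constant tuple; this only adds a point
          -- to W.
          answer : (q : Request) → Segment (length q) → ∣ str N ∣
          answer q = ε (Answers q) (λ _ → Injection.to bigᴺ some)

          -- Besides the answers, the κ points of N make W large enough to be a base, and the old
          -- points make the stages increase.
          New : Set ℓ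
          New = Σ Request (λ q → Segment (length q)) ⊎ (k ⊎ Old)

          new : New → ∣ str N ∣
          new = [ (λ (q , s) → answer q s) , [ Injection.to bigᴺ , old ]′ ]′

          New≤Z : New ↣ Z
          New≤Z = Σ≤Z Request≤Z (Segment≤Z ∘ length) ⊎ᶻ (k≤Z ⊎ᶻ Old≤Z)
            where
            Old≤Z : Old ↣ Z
            Old≤Z = Σ≤Z (Segment≤Z i) (λ (j , j<i) → proj₂ (proj₂ (rec j j<i)))
            Request≤Z : Request ↣ Z
            Request≤Z = functions (k≤Z ⊎ᶻ (Old≤Z ⊎ᶻ α≤Z)) ×ᶻ (k≤Z ×ᶻ (functions Mᵇ≤Z ×ᶻ functions Mᵇ≤Z))

        Next : ∀ i → Earlier i → P → Set (suc ℓ)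
        Next i rec (M , _) = ∀ t → ∃[ y ] incl M y ≡ incl N (Stage.new i rec t)

        next : ∀ i rec → ∃[ p ] Next i rec p
        next i rec = from-hull (hull N New new)
          where
          open Stage i rec
          from-hull : Σ[ M ∈ Model 𝔐 ] (M ≼ N × (∀ t → ∃[ y ] incl M y ≡ incl N (new t)) × (∣ str M ∣ ↣ (New ⊎ ∣ AEC.LS 𝒦 ∣ᶜ))) →
                      ∃[ p ] Next i rec p
          from-hull (M , M≼N , covers , M≤) = (M , M≼N , (New≤Z ⊎ᶻ LS≤Z) ⊙ M≤) , covers

        module Closed (chosen : k → P) (spec : ∀ i → Next i (λ j _ → chosen j) (chosen i)) where

          Nᵢ : k → Model 𝔐
          Nᵢ = proj₁ ∘ chosen

          module Stageᵢ i = Stage i (λ j _ → chosen j)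

          increasing : ∀ {i j} → i < j → Nᵢ i ≼ Nᵢ j
          increasing {i} {j} i<j = ⊆⇒≼ (Nᵢ i) (Nᵢ j) λ x → let (y , e) = spec j (inj₂ (inj₂ ((i , i<j) , x))) in
            y , trans e (embed-incl (proj₁ (proj₂ (chosen i))) x)

          open Union N Nᵢ increasing (λ i → proj₁ (proj₂ (chosen i))) public renaming (union-model to W; union≼N to W≼N)

          W≤Z : ∣ str W ∣ ↣ Z
          W≤Z = Σ≤Z k≤Z (λ i → proj₂ (proj₂ (chosen i))) ⊙
            mk↣ {to = λ x → let (i , y , _) = union-covered x in i , y} λ {x} {x′} e →
              incl-injective W (trans (sym (proj₂ (proj₂ (union-covered x))))
                (trans (cong (λ (i , y) → incl (Nᵢ i) y) e) (proj₂ (proj₂ (union-covered x′)))))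

          in-W : ∀ i t → ∃[ y ] incl W y ≡ incl N (Stageᵢ.new i t)
          in-W i t = let (y , e) = spec i t in embed (Nᵢ≼union i) y , trans (embed-incl (Nᵢ≼union i) y) e

          bigᵂ : Big 𝔐 κ W
          bigᵂ = mk↣ {to = λ j → proj₁ (in-W some (inj₂ (inj₁ j)))} λ {j} {j′} e → Injection.injective bigᴺ
            (incl-injective N (trans (sym (proj₂ (in-W some (inj₂ (inj₁ j)))))
              (trans (cong (incl W) e) (proj₂ (in-W some (inj₂ (inj₁ j′)))))))

          -- By regularity the small set of parameters from W appears before some stage i. There the
          -- type of x over them is requested, with x itself as an answer, and the answer that was
          -- chosen lies in W.
          N-coh-W : Coh (incl N) W [ incl W , a ]′
          N-coh-W = coh realise′
            where
            realise′ : ∀ {X Y : Set ℓ} → IsSmall X → IsSmall Y → (x : X → ∣ str N ∣) (y : Y → ∣ str W ∣ ⊎ α) →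
                       ∃[ x′ ] (incl W ∘ x′) ∼[ [ incl W , a ]′ ∘ y ] (incl N ∘ x)
            realise′ {X} {Y} small-X small-Y x y = at-stage (bound small-Y stage)
              where
              stage : Y → k
              stage j = [ proj₁ ∘ union-covered , (λ _ → some) ]′ (y j)
              at-stage : ∃[ i ] (∀ j → stage j < i) → ∃[ x′ ] (incl W ∘ x′) ∼[ [ incl W , a ]′ ∘ y ] (incl N ∘ x)
              at-stage (i , stage<i) = from-bound (bound (small-⊎ small-X small-Y) [ Injection.to X≤k , Injection.to Y≤k ]′)
                where
                open Stageᵢ i
                X≤k : X ↣ k
                X≤k = proj₁ (≰⇒<# κ (setoid X) small-X)
                Y≤k : Y ↣ k
                Y≤k = proj₁ (≰⇒<# κ (setoid Y) small-Y)
                locate : ∀ w → [ proj₁ ∘ union-covered , (λ _ → some) ]′ w < i → ∃[ c ] point c ≡ [ incl W , a ]′ w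
                locate (inj₁ w) <i = let (j , z , e) = union-covered w in
                  inj₂ (inj₁ ((j , <i) , z)) , trans (embed-incl (proj₁ (proj₂ (chosen j))) z) e
                locate (inj₂ v) _ = inj₂ (inj₂ v) , refl
                c : Y → Params
                c j = proj₁ (locate (y j) (stage<i j))
                c-spec : ∀ j → point (c j) ≡ [ incl W , a ]′ (y j)
                c-spec j = proj₂ (locate (y j) (stage<i j))
                d : k → Params
                d = spread Y≤k c (inj₁ some)
                b : k → ∣ str N ∣
                b = spread X≤k x (Injection.to bigᴺ some)
                module _ (γ : k) (below-γ : ∀ z → [ Injection.to X≤k , Injection.to Y≤k ]′ z < γ) where
                  b-at : Segment γ → ∣ str N ∣
                  b-at s = b (proj₁ s)
                  d-at : Segment γ → U
                  d-at s = point (d (proj₁ s))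
                  answered : ∃[ t ] (incl Mᵇ ∘ t) ∼[ nothing ] [ incl N ∘ b-at , d-at ]′ →
                             ∃[ x′ ] (incl W ∘ x′) ∼[ [ incl W , a ]′ ∘ y ] (incl N ∘ x)
                  answered (t , p) = (λ z → proj₁ (in-W i (inj₁ (q , s z)))) ,
                      ∼-resp (λ z → sym (proj₂ (in-W i (inj₁ (q , s z))))) (λ z → cong (incl N) (spread-to X≤k x _ z))
                        (∼-base (λ j → inj₁ (s′ j) , trans (cong point (spread-to Y≤k c _ j)) (c-spec j))
                          (∼-reindex s same))
                    where
                    default : ∣ str Mᵇ ∣
                    default = Injection.to bigᵇ some
                    q : Request
                    q = d , γ , spread segment↣ (t ∘ inj₁) default , spread segment↣ (t ∘ inj₂) default
                    s : X → Segment γ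
                    s z = Injection.to X≤k z , below-γ (inj₁ z)
                    s′ : Y → Segment γ
                    s′ j = Injection.to Y≤k j , below-γ (inj₂ j)
                    asked : Answers q b-at
                    asked = ∼-resp {a = [ incl N ∘ b-at , d-at ]′} {b = incl Mᵇ ∘ t} (λ _ → refl)
                      [ (λ z → cong (incl Mᵇ) (sym (spread-to segment↣ (t ∘ inj₁) default z)))
                      , (λ z → cong (incl Mᵇ) (sym (spread-to segment↣ (t ∘ inj₂) default z))) ] (∼-sym p)
                    answers : Answers q (answer q)
                    answers = ε-spec (Answers q) _ (b-at , asked)
                    same : incl N ∘ answer q ∼[ [ d-at , nothing ]′ ] incl N ∘ b-at
                    same = ∼-split (∼-trans answers (∼-sym asked))
                from-bound : ∃[ γ ] (∀ z → [ Injection.to X≤k , Injection.to Y≤k ]′ z < γ) →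
                             ∃[ x′ ] (incl W ∘ x′) ∼[ [ incl W , a ]′ ∘ y ] (incl N ∘ x)
                from-bound (γ , below-γ) = answered γ below-γ
                  (realise-type {M = Mᵇ} (Coh-over-base _ bigᵇ) (small-⊎ (small-Segment γ) (small-Segment γ)))

          a-coh-W : Coh a W (incl N)
          a-coh-W = from-free (free a bigᵂ W≼N)
            where
            from-free : ∃[ a* ] (a* ∼[ incl W ] a × Coh a* W (incl N)) → Coh a W (incl N)
            -- Let σ take a* to a over W. Then a*N ≡ aσ(N) ≡ aN over W, the second step being
            -- symmetry with σ(N) as b and N as b*. Hence a* ≡_N a.
            from-free (a* , conj σ fixes maps , coh-a*) = Coh-∼ (∼-base (λ x → inj₁ x , refl) (∼-split
              (∼-trans (conj σ fixes [ maps , (λ _ → refl) ])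
                (symmetry {M = W}
                  (Coh-conj (conj σ fixes [ maps , [ fixes , (λ _ → refl) ] ])
                    (Coh-mono {c′ = [ incl W , incl N ]′} (λ i → i , refl) [ (λ w → embed W≼N w , embed-incl W≼N w) , (λ x → x , refl) ] coh-a*))
                  N-coh-W (conj σ fixes (λ _ → refl)))))) coh-a*

        small-base : Σ[ W ∈ Model 𝔐 ] (W ≼ N × (∣ str W ∣ ↣ Z) × Coh a W (incl N))
        small-base = from-chosen (wf-choice wellFounded {Q = Next} next)
          where
          from-chosen : Σ[ f ∈ (k → P) ] (∀ i → Next i (λ j _ → f j) (f i)) →
                        Σ[ W ∈ Model 𝔐 ] (W ≼ N × (∣ str W ∣ ↣ Z) × Coh a W (incl N))
          from-chosen (chosen , spec) = W , W≼N , W≤Z , a-coh-W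
            where open Closed chosen spec

    coheir-L : PropertyL 𝔐 κ (Coheir 𝔐 κ)
    coheir-L α with lem {P = Σ[ M ∈ Model 𝔐 ] Big 𝔐 κ M}
    -- Without models of size at least κ there is no chain to consider, so any regular cardinal
    -- serves.
    ... | no none = κ , regular , λ μ regular-μ _ M _ _ big _ _ →
      let i = Injection.to (Regular.infinite regular-μ) 0 in contradiction (M i , big i) none
    ... | yes (Mᵇ , bigᵇ) = from-successor (Hartogs.regular-above lem ext (Monster.OR 𝔐) (Monster.segments-small 𝔐)
                              (Monster.small-bounded 𝔐) Z (k≤Z ⊙ Regular.infinite regular)
                              ((mk↣ {to = id} id ×ᶻ mk↣ {to = id} id) ×ᶻ Bool≤Z))
      where
      open Closure {∣ α ∣ᶜ} Mᵇ bigᵇ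
      module _ (l : Cardinal ℓ) (l≰Z : ¬ (Cardinal.size l ≤# setoid Z)) where
        local : LocalCharacter 𝔐 κ (Coheir 𝔐 κ) α l
        local μ regular-μ l≤μ M top chain big A A≈α = from-base (small-base top big-top a)
          where
          open IsChain chain
          big-top : Big 𝔐 κ top
          big-top = let i = Injection.to (Regular.infinite regular-μ) 0 in
            embed↣ (strongly {M i} {top} (increasing-top i)) ⊙ big i
          preimage : ∀ x → ∃[ i ] Bijection.to A≈α i ≡ x
          preimage x = let (i , e) = Bijection.surjective A≈α x in i , e refl
          a : ∣ α ∣ᶜ → U
          a = elem A ∘ proj₁ ∘ preimage
          enumerates : ∀ i → ∃[ x ] a x ≡ elem A i
          enumerates i = Bijection.to A≈α i , Bijection.injective A≈α (proj₂ (preimage (Bijection.to A≈α i)))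
          from-base : Σ[ W ∈ Model 𝔐 ] (W ≼ top × (∣ str W ∣ ↣ Z) × Coh a W (incl top)) → ∃[ i ] Coheir 𝔐 κ A (M i) top
          -- The size of W is at most Z and μ does not embed in Z, so by regularity of μ all of W
          -- lies in one M_i, and the base can be raised from W to M_i.
          from-base (W , W≼top , W≤Z , a-coh-W) = from-bound
              (Smallness.bound μ regular-μ (λ μ≤W → l≰Z (W≤Z ⊙ (μ≤W ⊙ l≤μ))) (proj₁ ∘ stage))
            where
            stage : ∀ w → ∃[ j ] ∃[ y ] incl (M j) y ≡ incl W w
            stage w = continuous-top _ (embed W≼top w , embed-incl W≼top w)
            from-bound : ∃[ i ] (∀ w → Cardinal._<_ μ (proj₁ (stage w)) i) → ∃[ i ] Coheir 𝔐 κ A (M i) top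
            from-bound (i , stage<i) = i , Coh⇒coheir A (M i) top (strongly (increasing-top i))
              (Coh-base W≼Mi (Coh-mono enumerates (λ x → x , refl) a-coh-W))
              where
              W≼Mi : W ≼ M i
              W≼Mi = ⊆⇒≼ W (M i) λ w →
                let (j , y , e) = stage w
                    Mj≼Mi = strongly {M j} {M i} (increasing j i (stage<i w))
                in embed Mj≼Mi y , trans (embed-incl Mj≼Mi y) e
      from-successor : Σ[ l ∈ Cardinal ℓ ] (Regular l × ¬ (Cardinal.size l ≤# setoid Z)) →
                       Σ[ l ∈ Cardinal ℓ ] (Regular l × LocalCharacter 𝔐 κ (Coheir 𝔐 κ) α l)
      from-successor (l , regular-l , l≰Z) = l , regular-l , local l l≰Z

    -- Canonicity: comparison with another independence relation

    module _ {r : Level} {ind : Ternary 𝔐 r} (independence : IsIndependence 𝔐 ind)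
      (ind-E : PropertyE 𝔐 κ ind) (ind-U : PropertyU 𝔐 κ ind) where
      open IsIndependence independence

      ind-mono : ∀ {I : Set ℓ} {a : I → U} {A M N N′} → (∀ i → ∃[ i′ ] elem A i′ ≡ a i) → M ≼ N′ → N′ ≼ N →
        ind A M N → ind (range a) M N′
      ind-mono sub M≼N′ N′≼N h = monotonicity h (λ { (i , refl) → sub i }) (strongIn M≼N′) (strongIn N′≼N)

      ind-conj : ∀ {I : Set ℓ} {a : I → U} {M N N′} (σ : Aut) → (∀ m → to σ (incl M m) ≡ incl M m) →
        (g : ∣ str N ∣ → ∣ str N′ ∣) → (∀ x → incl N′ (g x) ≡ to σ (incl N x)) → (∀ y → ∃[ x ] g x ≡ y) →
        ind (range a) M N → ind (range (to σ ∘ a)) M N′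
      ind-conj {a = a} {M} {N} {N′} σ fixes g g-spec g-onto = Equivalence.to (invariance (to σ , record
        { automorphism = iso σ
        ; fixes = λ { _ (() , _) }
        ; maps = λ { Fin.zero → id , id
                   ; (Fin.suc Fin.zero) → (λ { (m , refl) → m , sym (fixes m) }) , λ { (m , refl) → m , fixes m }
                   ; (Fin.suc (Fin.suc Fin.zero)) → (λ { (x , refl) → g x , g-spec x })
                       , λ { (y , refl) → let (x , e) = g-onto y in x , trans (sym (g-spec x)) (cong (incl N′) e) } } }))

      ind-extend : ∀ {I : Set ℓ} {a : I → U} {M N N′} → Big 𝔐 κ M → M ≼ N → N ≼ N′ → ind (range a) M N →
        ∃[ a′ ] (a′ ∼[ incl N ] a × ind (range a′) M N′)
      ind-extend {I} {a} {M} {N} {N′} big M≼N N≼N′ h =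
        enumerate (proj₂ ind-E (range a) M N N′ big (strongIn M≼N) (strongIn N≼N′) h)
        where
        enumerate : Σ[ A′ ∈ Subset 𝔐 ] (_≡[_]_ 𝔐 (one 𝔐 A′) (universe N) (one 𝔐 (range a)) × ind A′ M N′) →
                    ∃[ a′ ] (a′ ∼[ incl N ] a × ind (range a′) M N′)
        enumerate (A′ , (f , p) , q) = elem A′ ∘ proj₁ ∘ pre ,
            conj (toAut f automorphism) (λ x → fixes _ (x , refl)) (proj₂ ∘ pre) ,
            ind-mono {A = A′} (λ i → proj₁ (pre i) , refl) (≼-trans M≼N N≼N′) (≼-refl {N′}) q
          where
          open _∶_≡[_]_ p
          pre : ∀ i → ∃[ z ] f (elem A′ z) ≡ a i
          pre i = proj₂ (maps tt) (i , refl)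

      ind-free : ∀ {I : Set ℓ} (a : I → U) {M N} → Big 𝔐 κ M → M ≼ N →
        ∃[ a′ ] (a′ ∼[ incl M ] a × ind (range a′) M N)
      ind-free a {M} big M≼N = ind-extend big ≼-refl M≼N (proj₁ ind-E (range a) M big)

      ind-unique : ∀ {I : Set ℓ} {a a′ : I → U} {M N} → Big 𝔐 κ M → ind (range a) M N → ind (range a′) M N →
        a ∼[ incl M ] a′ → a ∼[ incl N ] a′
      ind-unique {a = a} {a′} {M} {N} big h h′ (conj σ fixed carried) =
        from-U (ind-U (range a) (range a′) M N (to σ) big h h′ (record
          { automorphism = iso σ
          ; fixes = λ { _ (m , refl) → fixed m }
          ; maps = λ _ → (λ { (i , refl) → i , sym (carried i) }) , λ { (i , refl) → i , carried i } }))
        where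
        from-U : ∃[ g ] (_∶_≡[_]_ 𝔐 g (one 𝔐 (range a)) (universe N) (one 𝔐 (range a′)) ×
                         (∀ x → x ∈ ⟪ range a ⟫ → g x ≡ to σ x)) → a ∼[ incl N ] a′
        from-U (g , p , agree) = conj (toAut g automorphism) (λ x → fixes _ (x , refl))
            (λ i → trans (agree _ (i , refl)) (carried i))
          where open _∶_≡[_]_ p

      -- Two extensions of a type, a coheir one and an ind-independent one, that
      -- disagree over b yield the order property: the next a_i is ind-independent
      -- from the earlier copies of N, the next copy of N is free from the a_j.

      module _ {X : Set ℓ} (small-X : IsSmall X) {M N : Model 𝔐} (big : Big 𝔐 κ M) (M≼N : M ≼ N)
        {a a′ : X → U} (coh-a : Coh a M (incl N)) (ind-a′ : ind (range a′) M N) (a′∼a : a′ ∼[ incl M ] a) where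

        private
          -- The second sequence is kept as automorphisms over M, because `ind` accepts only models
          -- on its right and the image of N is again a model over M.
          Fixing : Set (suc ℓ)
          Fixing = Σ[ σ ∈ Aut ] (∀ m → to σ (incl M m) ≡ incl M m)

          P : Set (suc ℓ)
          P = (X → U) × Fixing

          Earlier : k → Set (suc ℓ)
          Earlier i = ∀ j → j < i → P

          copy : Fixing → Model 𝔐
          copy (σ , _) = proj₁ (image-model σ N)

          M≼copy : ∀ σ → M ≼ copy σ
          M≼copy (σ , fixes) = ⊆⇒≼ M _ λ m → _ ,
            trans (proj₁ (proj₂ (proj₂ (image-model σ N))) (embed M≼N m)) (trans (cong (to σ) (embed-incl M≼N m)) (fixes m))

          copy≼ : ∀ σ N′ → (∀ x → ∃[ y ] incl N′ y ≡ to (proj₁ σ) (incl N x)) → copy σ ≼ N′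
          copy≼ (σ , fixes) N′ contains = ⊆⇒≼ _ N′ λ y →
            let (x , e) = proj₂ (proj₂ (proj₂ (image-model σ N))) y ; (z , e′) = contains x
            in z , trans e′ (trans (sym (proj₁ (proj₂ (proj₂ (image-model σ N))) x)) (cong (incl (copy (σ , fixes))) e))

          points : ∀ i → Earlier i → (X → U) → ∣ str M ∣ ⊎ (X ⊎ (Segment i × X)) → U
          points i rec aᵢ = [ incl M , [ aᵢ , (λ ((j , j<i) , x) → proj₁ (rec j j<i) x) ]′ ]′

          Next : ∀ i → Earlier i → P → Set (suc ℓ ⊔ r)
          Next i rec (aᵢ , σ , _) = (aᵢ ∼[ incl N ] a′)
            × (∀ j j<i → ind (range aᵢ) M (copy (proj₂ (rec j j<i))))
            × Coh (to σ ∘ incl N) M (points i rec aᵢ)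

          next : ∀ i rec → ∃[ p ] Next i rec p
          next i rec = step₁ (containing (∣ str N ∣ ⊎ (Segment i × ∣ str N ∣)) copies)
            where
            copies : ∣ str N ∣ ⊎ (Segment i × ∣ str N ∣) → U
            copies = [ incl N , (λ ((j , j<i) , x) → to (proj₁ (proj₂ (rec j j<i))) (incl N x)) ]′
            step₃ : ∀ aᵢ → aᵢ ∼[ incl N ] a′ → (∀ j j<i → ind (range aᵢ) M (copy (proj₂ (rec j j<i)))) →
              ∀ M* → (∀ u → ∃[ y ] incl M* y ≡ points i rec aᵢ u) →
              ∃[ b* ] (b* ∼[ incl M ] incl N × Coh b* M (incl M*)) → ∃[ p ] Next i rec p
            step₃ aᵢ aᵢ∼a′ ind-aᵢ M* covers (b* , b*∼N , coh-b*) with ∼-sym b*∼N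
            ... | conj σ fixes maps = (aᵢ , σ , fixes) , aᵢ∼a′ , ind-aᵢ , Coh-mono (λ x → x , sym (maps x)) covers coh-b*
            step₂ : ∀ N* (covers : ∀ u → ∃[ y ] incl N* y ≡ copies u) →
              ∃[ aᵢ ] (aᵢ ∼[ incl N ] a′ × ind (range aᵢ) M N*) → ∃[ p ] Next i rec p
            step₂ N* covers (aᵢ , aᵢ∼a′ , ind-aᵢ) = from-cover (containing _ (points i rec aᵢ))
              where
              from-cover : Σ[ M* ∈ Model 𝔐 ] (∀ u → ∃[ y ] incl M* y ≡ points i rec aᵢ u) → ∃[ p ] Next i rec p
              from-cover (M* , covers′) = step₃ aᵢ aᵢ∼a′
                (λ j j<i → let σ = proj₂ (rec j j<i) in
                  ind-mono (λ x → x , refl) (M≼copy σ) (copy≼ σ N* (λ x → covers (inj₂ ((j , j<i) , x)))) ind-aᵢ)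
                M* covers′ (free (incl N) big (⊆⇒≼ M M* (covers′ ∘ inj₁)))
            step₁ : Σ[ N* ∈ Model 𝔐 ] (∀ u → ∃[ y ] incl N* y ≡ copies u) → ∃[ p ] Next i rec p
            step₁ (N* , covers) = step₂ N* covers (ind-extend big M≼N (⊆⇒≼ N N* (covers ∘ inj₁)) ind-a′)

        module Sequence (chosen : k → P) (spec : ∀ i → Next i (λ j _ → chosen j) (chosen i))
          {N₀ : Model 𝔐} (N₀≼N : N₀ ≼ N) (small-N₀ : IsSmall ∣ str N₀ ∣)
          {M₀ : Model 𝔐} (M₀≼M : M₀ ≼ M) (small-M₀ : IsSmall ∣ str M₀ ∣) where

          A : k → X → U
          A i = proj₁ (chosen i)
          σ : k → Aut
          σ j = proj₁ (proj₂ (chosen j))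
          B : k → ∣ str N₀ ∣ → U
          B j = to (σ j) ∘ incl N₀

          A∼a′ : ∀ i → A i ∼[ incl M ] a′
          A∼a′ i = ∼-base (λ m → embed M≼N m , embed-incl M≼N m) (proj₁ (spec i))

          over-M₀ : ∀ {I : Set ℓ} {c d : I → U} → c ∼[ incl M ] d → c ∼[ incl M₀ ] d
          over-M₀ = ∼-base (λ m → embed M₀≼M m , embed-incl M₀≼M m)

          down : ∀ i j → j < i → [ A i , B j ]′ ∼[ incl M₀ ] [ a′ , incl N₀ ]′
          -- Both a_i and σ_j(a′) are `ind`-independent from σ_j(N) over M, the latter by
          -- invariance. Uniqueness for `ind` makes them agree over σ_j(N), and undoing σ_j leaves
          -- a′ with N₀.
          down i j j<i = ∼-trans (∼-join (∼-base in-copy same)) (over-M₀ (∼-sym moved))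
            where
            fixes = proj₂ (proj₂ (chosen j))
            moved : [ a′ , incl N₀ ]′ ∼[ incl M ] [ to (σ j) ∘ a′ , B j ]′
            moved = conj (σ j) fixes [ (λ _ → refl) , (λ _ → refl) ]
            same : A i ∼[ incl (copy (proj₂ (chosen j))) ] to (σ j) ∘ a′
            same = ind-unique big (proj₁ (proj₂ (spec i)) j j<i)
              (let (_ , g , g-spec , g-onto) = image-model (σ j) N in
                ind-conj (σ j) fixes g g-spec g-onto ind-a′)
              (∼-trans (A∼a′ i) (conj (σ j) fixes (λ _ → refl)))
            in-copy : ∀ u → ∃[ y ] incl (copy (proj₂ (chosen j))) y ≡ [ B j , incl M₀ ]′ u
            in-copy (inj₁ x) = _ , trans (proj₁ (proj₂ (proj₂ (image-model (σ j) N))) (embed N₀≼N x))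
                                         (cong (to (σ j)) (embed-incl N₀≼N x))
            in-copy (inj₂ m) = _ , trans (embed-incl (M≼copy (proj₂ (chosen j))) (embed M₀≼M m)) (embed-incl M₀≼M m)

          up : ∀ i j → i ≤ j → [ A i , B j ]′ ∼[ incl M₀ ] [ a , incl N₀ ]′
          up i j i≤j = over-M₀ (moved-to-a (∼-trans (A∼a′ i) a′∼a))
            where
            in-points : i ≤ j → ∀ u → ∃[ v ] points j (λ j _ → chosen j) (A j) v ≡ [ incl M , A i ]′ u
            in-points _           (inj₁ m) = inj₁ m , refl
            in-points (inj₁ i<j)  (inj₂ x) = inj₂ (inj₂ ((i , i<j) , x)) , refl
            in-points (inj₂ refl) (inj₂ x) = inj₂ (inj₁ x) , refl
            coh-copy : Coh (to (σ j) ∘ incl N) M [ incl M , A i ]′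
            coh-copy = Coh-mono (λ x → x , refl) (in-points i≤j) (proj₂ (proj₂ (spec j)))
            shrink : ∀ {c d : X → U} {e : ∣ str N ∣ → U} → [ c , e ]′ ∼[ incl M ] [ d , incl N ]′ →
                     [ c , e ∘ embed N₀≼N ]′ ∼[ incl M ] [ d , incl N₀ ]′
            shrink p = ∼-resp [ (λ _ → refl) , (λ _ → refl) ] [ (λ _ → refl) , embed-incl N₀≼N ]
                         (∼-reindex (Sum.map id (embed N₀≼N)) p)
            moved-to-a : A i ∼[ incl M ] a → [ A i , B j ]′ ∼[ incl M ] [ a , incl N₀ ]′
            -- Let τ take a_i to a over M. Then τσ_j(N) is free from a, and a is free from N, so the
            -- symmetry lemma with b = N and b* = τσ_j(N) gives aτσ_j(N) ≡ aN over M.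
            moved-to-a (conj τ fixed carried) = ∼-resp [ (λ _ → refl) , (λ x → cong (to (σ j)) (embed-incl N₀≼N x)) ] (λ _ → refl)
              (shrink (∼-trans (conj τ fixed [ carried , (λ _ → refl) ]) (∼-sym (symmetry {M = M}
                (Coh-mono (λ x → x , refl) [ (λ m → embed M≼N m , embed-incl M≼N m) , (λ x → x , refl) ] coh-a)
                (Coh-conj (conj τ fixed [ (λ _ → refl) , [ fixed , carried ] ]) coh-copy)
                (∼-sym (conj (τ ∘ᴬ σ j) (λ m → trans (cong (to τ) (proj₂ (proj₂ (chosen j)) m)) (fixed m)) (λ _ → refl)))))))

          agree : a′ ∼[ incl N₀ ] a
          agree = ∼-sym (∼-base (λ x → inj₁ x , refl) (∼-split
            (order-lemma small-X small-N₀ {M₀} small-M₀ A B up down)))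

        agree-locally : ∀ {N₀} → N₀ ≼ N → IsSmall ∣ str N₀ ∣ → a′ ∼[ incl N₀ ] a
        -- Any small submodel of M can be the base of the order property, because N₀, over which a′
        -- and a are compared, enters through the tuples.
        agree-locally N₀≼N small-N₀ = go (wf-choice wellFounded {Q = Next} next) (small-submodel M)
          where
          go : Σ[ f ∈ (k → P) ] (∀ i → Next i (λ j _ → f j) (f i)) →
               Σ[ M₀ ∈ Model 𝔐 ] (M₀ ≼ M × IsSmall ∣ str M₀ ∣) → _
          go (chosen , spec) (_ , M₀≼M , small-M₀) = Sequence.agree chosen spec N₀≼N small-N₀ M₀≼M small-M₀

      Coh⇒ind : ∀ {I : Set ℓ} {a : I → U} {M N} → Big 𝔐 κ M → M ≼ N → Coh a M (incl N) → ind (range a) M N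
      Coh⇒ind {I} {a} {M} {N} big M≼N coh-a = from-free (ind-free a big M≼N)
        where
        from-free : ∃[ a′ ] (a′ ∼[ incl M ] a × ind (range a′) M N) → ind (range a) M N
        from-free (a′ , a′∼a , ind-a′) = transport (locally⇒globally {M = N} λ small-X x N₀ N₀≼N small-N₀ →
            agree-locally small-X big M≼N (Coh-mono (λ i → x i , refl) (λ n → n , refl) coh-a)
              (ind-mono (λ i → x i , refl) M≼N ≼-refl ind-a′) (∼-reindex x a′∼a) N₀≼N small-N₀)
          where
          transport : a′ ∼[ incl N ] a → ind (range a) M N
          transport (conj σ fixes maps) = ind-mono (λ i → i , maps i) M≼N ≼-refl
            (ind-conj σ (λ m → trans (cong (to σ) (sym (embed-incl M≼N m))) (trans (fixes _) (embed-incl M≼N m)))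
              id (sym ∘ fixes) (λ y → y , refl) ind-a′)

      -- The direction from `ind` to coheir follows from the other one: a coheir extension of the
      -- type over M is `ind`-independent by `Coh⇒ind`, so uniqueness for `ind` identifies it with A
      -- over N.
      canonical : ∀ A M N → Big 𝔐 κ M → ind A M N ⇔ Coheir 𝔐 κ A M N
      canonical A M N big = mk⇔
        (λ h → let M≼N = strongly (domain h) in Coh⇒coheir A M N M≼N (from-free M≼N h (free (elem A) big M≼N)))
        (λ h → Coh⇒ind big (strongly (proj₁ h)) (coheir⇒Coh A M N h))
        where
        from-free : M ≼ N → ind A M N → ∃[ a′ ] (a′ ∼[ incl M ] elem A × Coh a′ M (incl N)) → Coh (elem A) M (incl N)
        from-free M≼N h (a′ , a′∼a , coh-a′) = Coh-∼ (ind-unique big (Coh⇒ind big M≼N coh-a′) h a′∼a) coh-a′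

theorem6p7 : ∀ {ℓ r} →
    (∀ {a} → ExcludedMiddle a) →
    (∀ {a b} → Extensionality a b) →
    (L : Signature ℓ) (𝒦 : AEC L) →
    Amalgamation 𝒦 → JointEmbedding 𝒦 → NoMaximalModels 𝒦 →
    (𝔐 : Monster 𝒦) →
    (κ : Cardinal ℓ) → Regular κ → Cardinal.size (AEC.LS 𝒦) <# Cardinal.size κ →
    FullyTame 𝔐 κ → FullyShort 𝔐 κ → ¬ WeakOrderProperty 𝔐 κ →
    PropertyE 𝔐 κ (Coheir 𝔐 κ) →
    (PropertyC 𝔐 κ (Coheir 𝔐 κ) ×
    PropertyT 𝔐 κ (Coheir 𝔐 κ) ×
    PropertyT* 𝔐 κ (Coheir 𝔐 κ) ×
    PropertyS 𝔐 κ (Coheir 𝔐 κ) ×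
    PropertyU 𝔐 κ (Coheir 𝔐 κ) ×
    PropertyL 𝔐 κ (Coheir 𝔐 κ)) ×
    ((ind : Ternary 𝔐 r) → IsIndependence 𝔐 ind →
    PropertyE 𝔐 κ ind → PropertyU 𝔐 κ ind →
    ∀ A M N → Big 𝔐 κ M → ind A M N ⇔ Coheir 𝔐 κ A M N)
theorem6p7 lem ext L 𝒦 _ _ _ 𝔐 κ regular LS<κ tame short noOrder E =
    (coheir-C , coheir-T , coheir-T* , coheir-S , coheir-U , coheir-L) ,
    λ ind independence ind-E ind-U → canonical independence ind-E ind-U
  where
  open CoheirTheory lem ext 𝔐 κ regular LS<κ tame short noOrder
  open Extension E
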